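{- Let $F\in\mathbb{Z}[x_0,\ldots,x_n]$ be a form. Then $\mathrm{o}(F)=n+1$ if and only if $\mathrm{o}(F_p)=n+1$ for all except finitely many primes $p$.
   Context: $F_p\in\mathbb{F}_p[x_0,\dots,x_n]$ denotes the reduction of $F$ modulo $p$. The order of a form over a field $K$ is the smallest integer $m$ such that the form is equivalent, via an invertible linear change of variables over $K$, to a form explicitly involving only $m$ variables; $\mathrm{o}(F)$ is the order over $\mathbb{Q}$ and $\mathrm{o}(F_p)$ the order over $\mathbb{F}_p$. -}

module Defs where

open import Algebra.Bundles using (CommutativeRing)
import Algebra.Definitions.RawMonoid as RawMonoidDefinitions
open import Data.Bool.Base using (if_then_else_)
open import Data.Fin.Base using (Fin)
import Data.Fin.Properties as Fin
open import Data.Fin.Subset using (Subset; ∣_∣; _∈_)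
open import Data.Integer.Base as ℤ using (ℤ; +_)
import Data.Integer.Properties as ℤ
open import Data.Integer.Divisibility.Signed using (_∣_; divides)
open import Data.Integer.Tactic.RingSolver using (solve-∀)
open import Data.List.Base as List using (List; []; _∷_; _++_)
open import Data.Nat.Base using (ℕ; zero; suc; _≤_)
import Data.Nat.Base as ℕ
import Data.Nat.Properties as ℕ
open import Data.Product.Base using (_×_; _,_; ∃; ∃-syntax; map₁)
open import Data.Rational.Base as ℚ using (ℚ)
import Data.Rational.Properties as ℚ
open import Data.Vec.Base as Vec using (Vec; _[_]≔_)
open import Data.Vec.Properties using (≡-dec)
open import Data.Vec.Functional as Vector using (Vector)
open import Level using (Level; 0ℓ; _⊔_)
open import Relation.Binary.PropositionalEquality using (_≡_; _≢_; refl; sym; trans; cong; cong₂)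
open import Relation.Nullary using (¬_; does)

module Polynomials {c ℓ : Level} (R : CommutativeRing c ℓ) where

  open CommutativeRing R using (Carrier; _≈_; _+_; _*_; 0#; 1#; +-rawMonoid)
  open RawMonoidDefinitions +-rawMonoid using (sum)

  -- A polynomial in x₀, …, xₙ₋₁ is a formal sum of terms a·x^α.  Exponents may
  -- repeat and coefficients may vanish, so the list itself carries no meaning:
  -- properties of a polynomial are to be read off from `coeff` only.
  Poly : ℕ → Set c
  Poly n = List (Carrier × Vec ℕ n)

  coeff : ∀ {n} → Poly n → Vec ℕ n → Carrier
  coeff []            α = 0#
  coeff ((a , β) ∷ F) α = (if does (≡-dec ℕ._≟_ α β) then a else 0#) + coeff F α

  -- The zero polynomial is a form of every degree.
  IsForm : ∀ {n} → ℕ → Poly n → Set ℓ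
  IsForm d F = ∀ α → ¬ (coeff F α ≈ 0#) → Vec.sum α ≡ d

  constant : ∀ {n} → Carrier → Poly n
  constant a = (a , Vec.replicate _ 0) ∷ []

  infixl 7 _*ₚ_
  infixr 8 _^ₚ_

  _*ₚ_ : ∀ {n} → Poly n → Poly n → Poly n
  _*ₚ_ = List.cartesianProductWith λ where
    (a , α) (b , β) → a * b , Vec.zipWith ℕ._+_ α β

  _^ₚ_ : ∀ {n} → Poly n → ℕ → Poly n
  F ^ₚ zero  = constant 1#
  F ^ₚ suc k = F *ₚ F ^ₚ k

  -- F(L₀, …, Lₙ₋₁); concatenation of lists of terms is addition.
  substitute : ∀ {n m} → Poly n → Vector (Poly m) n → Poly m
  substitute F L = List.concatMap (λ where
    (a , α) → constant a *ₚ Vector.foldr _*ₚ_ (constant 1#) (λ i → L i ^ₚ Vec.lookup α i)) F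

  Matrix : ℕ → Set c
  Matrix n = Fin n → Fin n → Carrier

  _·_ : ∀ {n} → Matrix n → Matrix n → Matrix n
  (A · B) i j = sum λ k → A i k * B k j

  identity : ∀ {n} → Matrix n
  identity i j = if does (i Fin.≟ j) then 1# else 0#

  _≈ₘ_ : ∀ {n} → Matrix n → Matrix n → Set ℓ
  A ≈ₘ B = ∀ i j → A i j ≈ B i j

  Invertible : ∀ {n} → Matrix n → Set (c ⊔ ℓ)
  Invertible A = ∃[ B ] A · B ≈ₘ identity × B · A ≈ₘ identity

  linearForm : ∀ {n} → Vector Carrier n → Poly n
  linearForm a = List.tabulate λ j → a j , Vec.replicate _ 0 [ j ]≔ 1

  -- The linear change of variables xᵢ ↦ Σⱼ Aᵢⱼ xⱼ.
  changeVariables : ∀ {n} → Matrix n → Poly n → Poly n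
  changeVariables A F = substitute F λ i → linearForm (A i)

  _≈ₚ_ : ∀ {n} → Poly n → Poly n → Set ℓ
  F ≈ₚ G = ∀ α → coeff F α ≈ coeff G α

  _∼_ : ∀ {n} → Poly n → Poly n → Set (c ⊔ ℓ)
  F ∼ G = ∃[ A ] Invertible A × G ≈ₚ changeVariables A F

  Involves : ∀ {n} → Poly n → Fin n → Set ℓ
  Involves F i = ∃[ α ] ¬ (coeff F α ≈ 0#) × Vec.lookup α i ≢ 0

  InvolvesOnly : ∀ {n} → Poly n → ℕ → Set ℓ
  InvolvesOnly {n} F m = ∃[ S ] ∣ S ∣ ≡ m × (∀ (i : Fin n) → Involves F i → i ∈ S)

  ReducesTo : ∀ {n} → Poly n → ℕ → Set (c ⊔ ℓ)
  ReducesTo F m = ∃[ G ] F ∼ G × InvolvesOnly G m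

  -- "The order of F is m".  This is a relation rather than a function since over
  -- an arbitrary R the minimum cannot be computed.
  HasOrder : ∀ {n} → Poly n → ℕ → Set (c ⊔ ℓ)
  HasOrder F m = ReducesTo F m × (∀ k → ReducesTo F k → m ≤ k)

  infix  4 _≈ₘ_ _≈ₚ_ _∼_
  infixl 7 _·_

open Polynomials public using (Poly; IsForm; HasOrder)

ℤ-ring ℚ-ring : CommutativeRing 0ℓ 0ℓ
ℤ-ring = ℤ.+-*-commutativeRing
ℚ-ring = ℚ.+-*-commutativeRing

-- Congruence is a record, not a synonym for divisibility, so that x and y can be
-- inferred from a proof of it.
infix 4 _≡_mod_
record _≡_mod_ (x y : ℤ) (p : ℕ) : Set where
  constructor congruent
  field p∣x-y : + p ∣ x ℤ.- y

-- ℤ/pℤ, presented as the setoid of integers modulo p.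
𝔽 : ℕ → CommutativeRing 0ℓ 0ℓ
𝔽 p = record
  { Carrier = ℤ
  ; _≈_ = λ x y → x ≡ y mod p
  ; _+_ = ℤ._+_
  ; _*_ = ℤ._*_
  ; -_ = ℤ.-_
  ; 0# = + 0
  ; 1# = + 1
  ; isCommutativeRing = record
    { isRing = record
      { +-isAbelianGroup = record
        { isGroup = record
          { isMonoid = record
            { isSemigroup = record
              { isMagma = record
                { isEquivalence = record
                  { refl = reflexive refl ; sym = sym′ ; trans = trans′ }
                ; ∙-cong = +-cong }
              ; assoc = λ x y z → reflexive (ℤ.+-assoc x y z) }
            ; identity = (λ x → reflexive (ℤ.+-identityˡ x)) , λ x → reflexive (ℤ.+-identityʳ x) }
          ; inverse = (λ x → reflexive (ℤ.+-inverseˡ x)) , λ x → reflexive (ℤ.+-inverseʳ x)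
          ; ⁻¹-cong = neg-cong }
        ; comm = λ x y → reflexive (ℤ.+-comm x y) }
      ; *-cong = *-cong
      ; *-assoc = λ x y z → reflexive (ℤ.*-assoc x y z)
      ; *-identity = (λ x → reflexive (ℤ.*-identityˡ x)) , λ x → reflexive (ℤ.*-identityʳ x)
      ; distrib = (λ x y z → reflexive (ℤ.*-distribˡ-+ x y z)) , λ x y z → reflexive (ℤ.*-distribʳ-+ x y z) }
    ; *-comm = λ x y → reflexive (ℤ.*-comm x y) }
  }
  where
  reflexive : ∀ {x y} → x ≡ y → x ≡ y mod p
  reflexive {x} refl = congruent (divides (+ 0) (ℤ.+-inverseʳ x))

  sym′ : ∀ {x y} → x ≡ y mod p → y ≡ x mod p
  sym′ {x} {y} (congruent (divides q e)) = congruent (divides (ℤ.- q)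
    (trans (lemma x y) (trans (cong ℤ.-_ e) (ℤ.neg-distribˡ-* q (+ p)))))
    where
    lemma : ∀ x y → y ℤ.- x ≡ ℤ.- (x ℤ.- y)
    lemma = solve-∀

  trans′ : ∀ {x y z} → x ≡ y mod p → y ≡ z mod p → x ≡ z mod p
  trans′ {x} {y} {z} (congruent (divides q e)) (congruent (divides r f)) = congruent (divides (q ℤ.+ r)
    (trans (lemma x y z) (trans (cong₂ ℤ._+_ e f) (sym (ℤ.*-distribʳ-+ (+ p) q r)))))
    where
    lemma : ∀ x y z → x ℤ.- z ≡ (x ℤ.- y) ℤ.+ (y ℤ.- z)
    lemma = solve-∀

  +-cong : ∀ {x y u v} → x ≡ y mod p → u ≡ v mod p → x ℤ.+ u ≡ y ℤ.+ v mod p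
  +-cong {x} {y} {u} {v} (congruent (divides q e)) (congruent (divides r f)) = congruent (divides (q ℤ.+ r)
    (trans (lemma x y u v) (trans (cong₂ ℤ._+_ e f) (sym (ℤ.*-distribʳ-+ (+ p) q r)))))
    where
    lemma : ∀ x y u v → (x ℤ.+ u) ℤ.- (y ℤ.+ v) ≡ (x ℤ.- y) ℤ.+ (u ℤ.- v)
    lemma = solve-∀

  *-cong : ∀ {x y u v} → x ≡ y mod p → u ≡ v mod p → x ℤ.* u ≡ y ℤ.* v mod p
  *-cong {x} {y} {u} {v} (congruent (divides q e)) (congruent (divides r f)) = congruent (divides (x ℤ.* r ℤ.+ q ℤ.* v)
    (trans (lemma x y u v) (trans (cong₂ (λ s t → x ℤ.* s ℤ.+ t ℤ.* v) f e) (lemma′ x v q r (+ p)))))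
    where
    lemma : ∀ x y u v → x ℤ.* u ℤ.- y ℤ.* v ≡ x ℤ.* (u ℤ.- v) ℤ.+ (x ℤ.- y) ℤ.* v
    lemma = solve-∀
    lemma′ : ∀ x v q r s → x ℤ.* (r ℤ.* s) ℤ.+ (q ℤ.* s) ℤ.* v ≡ (x ℤ.* r ℤ.+ q ℤ.* v) ℤ.* s
    lemma′ = solve-∀

  neg-cong : ∀ {x y} → x ≡ y mod p → ℤ.- x ≡ ℤ.- y mod p
  neg-cong {x} {y} (congruent (divides q e)) = congruent (divides (ℤ.- q)
    (trans (lemma x y) (trans (cong ℤ.-_ e) (ℤ.neg-distribˡ-* q (+ p)))))
    where
    lemma : ∀ x y → ℤ.- x ℤ.- (ℤ.- y) ≡ ℤ.- (x ℤ.- y)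
    lemma = solve-∀

-- Applying a ring homomorphism to every term applies it to every coefficient.
overℚ : ∀ {n} → Poly ℤ-ring n → Poly ℚ-ring n
overℚ = List.map (map₁ (ℚ._/ 1))

-- The reduction map ℤ → 𝔽 p is the identity on representatives.
reduce : ∀ p {n} → Poly ℤ-ring n → Poly (𝔽 p) n
reduce p = List.map (map₁ λ (a : ℤ) → a)

{-# OPTIONS --safe #-}
-- Let A be an invertible matrix over a ring K with i-th column w.  By the chain
-- rule ∂ᵢ(F ∘ A) = (Σⱼ wⱼ ∂ⱼF) ∘ A, so if F ∘ A does not involve xᵢ then w ≠ 0 is a
-- linear relation between the partial derivatives of F, and the converse holds
-- when K is torsion-free.  The relations are the kernel of an integer matrix, and
-- elimination over ℤ leaves two cases.  Either some D ≠ 0 annihilates the kernel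
-- over every K; then F has full order wherever D is a unit.  Or there is an integer
-- relation w with some wᵢ ≠ 0; then the identity matrix with i-th column replaced
-- by w eliminates xᵢ over ℤ, hence over every K, and it is invertible wherever wᵢ is
-- a unit.  A nonzero integer is a unit in ℚ and in all but finitely many 𝔽ₚ.
module Submission where

open import Defs
open import Algebra.Bundles using (CommutativeRing; CommutativeSemiring; CommutativeMonoid; RawMonoid; RawSemiring)
import Algebra.Definitions.RawSemiring as RawSemiringDefinitions
open import Algebra.Morphism.Structures using (module MonoidMorphisms; module SemiringMorphisms)
import Algebra.Properties.CommutativeMonoid.Mult as CommutativeMonoidMult
import Algebra.Properties.CommutativeMonoid.Sum as MonoidSum
import Algebra.Properties.CommutativeSemigroup as CommutativeSemigroupProperties
import Algebra.Properties.Monoid.Mult as MonoidMult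
import Algebra.Properties.Ring as RingProperties
import Algebra.Properties.Semiring.Exp as SemiringExp
import Algebra.Properties.Semiring.Mult as SemiringMult
import Algebra.Properties.Semiring.Sum as SemiringSum
open import Algebra.Structures.Biased using (isCommutativeMonoidˡ; isCommutativeSemiringˡ)
open import Data.Bool.Base using (true; false; if_then_else_)
open import Data.Fin.Base using (Fin; zero; suc; punchIn)
import Data.Fin.Properties as Fin
open import Data.Fin.Subset using (Subset; ⊤; ⁅_⁆; ∁; ∣_∣)
import Data.Fin.Subset as Subset
import Data.Fin.Subset.Properties as Subset
open import Data.Integer.Base as ℤ using (ℤ; +_; -[1+_])
open import Data.Integer.Divisibility.Signed as ℤ∣ using (divides)
import Data.Integer.Properties as ℤ
import Data.Integer.Tactic.RingSolver as ℤ-Solver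
open import Data.List.Base as List using (List; []; _∷_; _++_)
open import Data.List.Extrema.Nat using (max; xs≤max; ⊥≤max)
import Data.List.Membership.DecPropositional as DecMembership
open import Data.List.Membership.Propositional using (_∈_; _∉_)
import Data.List.Membership.Propositional.Properties as ∈
import Data.List.Properties as List
open import Data.List.Relation.Unary.All as All using (_∷_)
open import Data.List.Relation.Unary.All.Properties using (All¬⇒¬Any)
open import Data.List.Relation.Unary.Any as Any using (here; there)
import Data.List.Relation.Unary.Any.Properties as Any
import Data.List.Relation.Unary.Unique.DecPropositional.Properties as Unique
open import Data.List.Relation.Unary.Unique.Propositional using (Unique; _∷_)
open import Data.Nat.Base as ℕ using (ℕ; zero; suc)
open import Data.Nat.Coprimality using (coprime-Bézout; prime⇒coprime)
open import Data.Nat.Divisibility as ℕ∣ using (_∣_)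
open import Data.Nat.GCD using (module Bézout)
import Data.Nat.ListAction as ℕ using (product)
open import Data.Nat.Primality using (Prime; ¬prime[1]; prime⇒nonZero)
open import Data.Nat.Primality.Factorisation using (factorise)
import Data.Nat.Properties as ℕ
open import Data.Product.Base as Product using (∃; _,_; proj₁; proj₂; map₁)
open import Data.Rational.Base as ℚ using ()
import Data.Rational.Properties as ℚ
open import Data.Rational.Unnormalised.Base as ℚᵘ using (mkℚᵘ; *≡*)
import Data.Rational.Unnormalised.Properties as ℚᵘ
open import Data.Sum.Base using (_⊎_; inj₁; inj₂; [_,_]′)
open import Data.Vec.Base as Vec using (Vec; []; _∷_; _[_]≔_; _[_]%=_)
open import Data.Vec.Functional as Vector using (Vector)
import Data.Vec.Properties as Vec
open import Function.Base using (_∘_; id)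
open import Function.Bundles using (_⇔_; mk⇔)
open import Level using (0ℓ)
open import Relation.Binary.Definitions using (DecidableEquality)
open import Relation.Binary.PropositionalEquality as ≡ using (_≡_; _≢_)
open import Relation.Binary.Structures using (IsEquivalence)
open import Relation.Nullary using (Dec; yes; no; does; ¬_; contradiction)
open import Relation.Nullary.Decidable using (dec-true; dec-false; decidable-stable; map′; ¬?)

-- Torsion is the obstacle that shapes the argument. In characteristic p a vanishing derivative does
-- not remove a variable, as x^p shows, so a relation between partial derivatives found over 𝔽ₚ need
-- not eliminate anything. The eliminating matrix is therefore built over ℤ, where it may fail to be
-- invertible, and is carried to K afterwards; only its invertibility is checked there.
--
-- For the other alternative, a rank computed over ℚ would say nothing about a given 𝔽ₚ.
-- Fraction-free elimination gathers all pivots into one integer D instead, and its annihilation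
-- property is quantified over every ring under ℤ, so one computation serves ℚ and all 𝔽ₚ at once.
--
-- The two implications are not proved by passing from one side to the other: in the first case both
-- sides of the equivalence hold, in the second both fail. Refuting the right-hand side there calls
-- for a prime outside an arbitrary finite list at which wᵢ is a unit, hence for the infinitude of
-- primes.

private
  variable
    n : ℕ

  _≟ᵛ_ : DecidableEquality (Vec ℕ n)
  _≟ᵛ_ = Vec.≡-dec ℕ._≟_

infixl 6 _⊕_

_⊕_ : Vec ℕ n → Vec ℕ n → Vec ℕ n
_⊕_ = Vec.zipWith ℕ._+_

exponents : ∀ {a} {A : Set a} → List (A Product.× Vec ℕ n) → List (Vec ℕ n)
exponents = List.map proj₂

-- Additive functionals on lists of terms

module LinearExtension {c ℓ m ℓᵐ} (R : CommutativeRing c ℓ) (M : CommutativeMonoid m ℓᵐ) where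
  private module R = CommutativeRing R
  open CommutativeMonoid M
  open MonoidMorphisms R.+-rawMonoid rawMonoid using (IsMonoidHomomorphism)
  open Polynomials R using (coeff; _*ₚ_; _≈ₚ_)
  open CommutativeSemigroupProperties commutativeSemigroup using (interchange)
  open MonoidSum M using (sum)
  open import Relation.Binary.Reasoning.Setoid setoid

  -- Coefficients and evaluations are instances of this fold, and differentiation acts on it through
  -- its adjoint. Values lie in any commutative monoid, so that evaluation in another semiring is
  -- covered.
  linear : (Vec ℕ n → R.Carrier → Carrier) → Poly R n → Carrier
  linear f []            = ε
  linear f ((a , α) ∷ F) = f α a ∙ linear f F

  linear-cong : ∀ {f g : Vec ℕ n → R.Carrier → Carrier} → (∀ α a → f α a ≈ g α a) → ∀ F → linear f F ≈ linear g F
  linear-cong f≈g []            = refl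
  linear-cong f≈g ((a , α) ∷ F) = ∙-cong (f≈g α a) (linear-cong f≈g F)

  linear-ε : ∀ (F : Poly R n) → linear (λ _ _ → ε) F ≈ ε
  linear-ε []      = refl
  linear-ε (_ ∷ F) = trans (identityˡ _) (linear-ε F)

  linear-∙ : ∀ (f g : Vec ℕ n → R.Carrier → Carrier) F →
    linear (λ α a → f α a ∙ g α a) F ≈ linear f F ∙ linear g F
  linear-∙ f g []            = sym (identityˡ ε)
  linear-∙ f g ((a , α) ∷ F) = trans (∙-congˡ (linear-∙ f g F)) (interchange _ _ _ _)

  linear-swap : ∀ {k} (f : Vec ℕ n → R.Carrier → Vec ℕ k → R.Carrier → Carrier) F G →
    linear (λ α a → linear (f α a) G) F ≈ linear (λ β b → linear (λ α a → f α a β b) F) G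
  linear-swap f []            G = sym (linear-ε G)
  linear-swap f ((a , α) ∷ F) G = trans (∙-congˡ (linear-swap f F G)) (sym (linear-∙ (f α a) _ G))

  linear-++ : ∀ (f : Vec ℕ n → R.Carrier → Carrier) F G → linear f (F ++ G) ≈ linear f F ∙ linear f G
  linear-++ f []            G = sym (identityˡ _)
  linear-++ f ((a , α) ∷ F) G = trans (∙-congˡ (linear-++ f F G)) (sym (assoc _ _ _))

  linear-map : ∀ {k} (f : Vec ℕ n → R.Carrier → Carrier) (g : R.Carrier Product.× Vec ℕ k → R.Carrier Product.× Vec ℕ n) F →
    linear f (List.map g F) ≈ linear (λ α a → f (proj₂ (g (a , α))) (proj₁ (g (a , α)))) F
  linear-map f g []      = refl
  linear-map f g (_ ∷ F) = ∙-congˡ (linear-map f g F)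

  linear-tabulate : ∀ {k} (f : Vec ℕ n → R.Carrier → Carrier) (t : Fin k → R.Carrier Product.× Vec ℕ n) →
    linear f (List.tabulate t) ≡ sum λ j → f (proj₂ (t j)) (proj₁ (t j))
  linear-tabulate {k = zero}  f t = ≡.refl
  linear-tabulate {k = suc k} f t = ≡.cong (_ ∙_) (linear-tabulate f (t ∘ suc))

  linear-*ₚ : ∀ (f : Vec ℕ n → R.Carrier → Carrier) F G →
    linear f (F *ₚ G) ≈ linear (λ α a → linear (λ β b → f (α ⊕ β) (a R.* b)) G) F
  linear-*ₚ f []            G = refl
  linear-*ₚ f ((a , α) ∷ F) G = trans (linear-++ f (List.map _ G) (F *ₚ G)) (∙-cong (linear-map f _ G) (linear-*ₚ f F G))

  -- Exactly what lets a sum over terms survive the merging of like terms and the loss of zero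
  -- terms.
  IsAdditive : (Vec ℕ n → R.Carrier → Carrier) → Set _
  IsAdditive f = ∀ α → IsMonoidHomomorphism (f α)

  module Additive (f : Vec ℕ n → R.Carrier → Carrier) (f-additive : IsAdditive f) where
    open module Homo α = IsMonoidHomomorphism (f-additive α) using (⟦⟧-cong; homo; ε-homo)

    private
      -- F with the terms collected by exponent, over a list Γ of possible exponents.
      normalForm : List (Vec ℕ n) → Poly R n → Poly R n
      normalForm Γ F = List.map (λ α → coeff F α , α) Γ

      normalForm-[] : ∀ Γ → linear f (normalForm Γ []) ≈ ε
      normalForm-[] []      = refl
      normalForm-[] (α ∷ Γ) = trans (∙-cong (ε-homo α) (normalForm-[] Γ)) (identityˡ ε)

      normalForm-∉ : ∀ Γ a α F → α ∉ Γ → linear f (normalForm Γ ((a , α) ∷ F)) ≈ linear f (normalForm Γ F)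
      normalForm-∉ []      a α F α∉ = refl
      normalForm-∉ (γ ∷ Γ) a α F α∉ with γ ≟ᵛ α
      ... | yes γ≡α = contradiction (here (≡.sym γ≡α)) α∉
      ... | no  _   = ∙-cong (⟦⟧-cong γ (R.+-identityˡ _)) (normalForm-∉ Γ a α F (α∉ ∘ there))

      -- As `Γ` has no repetitions, the coefficient at `α` is counted once, and additivity of `f α`
      -- splits off the new term.
      normalForm-∷ : ∀ {Γ} a α F → Unique Γ → α ∈ Γ →
        linear f (normalForm Γ ((a , α) ∷ F)) ≈ f α a ∙ linear f (normalForm Γ F)
      normalForm-∷ {γ ∷ Γ} a α F (γ∉ ∷ _) α∈ with γ ≟ᵛ α
      normalForm-∷ {γ ∷ Γ} a α F (γ∉ ∷ _) α∈ | yes ≡.refl = begin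
        f α (a R.+ coeff F α) ∙ linear f (normalForm Γ ((a , α) ∷ F))
          ≈⟨ ∙-cong (homo α _ _) (normalForm-∉ Γ a α F (All¬⇒¬Any γ∉)) ⟩
        f α a ∙ f α (coeff F α) ∙ linear f (normalForm Γ F)
          ≈⟨ assoc _ _ _ ⟩
        f α a ∙ (f α (coeff F α) ∙ linear f (normalForm Γ F)) ∎
      normalForm-∷ {γ ∷ Γ} a α F (_ ∷ Γ!) (here α≡γ) | no γ≢α = contradiction (≡.sym α≡γ) γ≢α
      normalForm-∷ {γ ∷ Γ} a α F (_ ∷ Γ!) (there α∈) | no γ≢α = begin
        f γ (R.0# R.+ coeff F γ) ∙ linear f (normalForm Γ ((a , α) ∷ F))
          ≈⟨ ∙-cong (⟦⟧-cong γ (R.+-identityˡ _)) (normalForm-∷ a α F Γ! α∈) ⟩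
        f γ (coeff F γ) ∙ (f α a ∙ linear f (normalForm Γ F))
          ≈⟨ x∙yz≈y∙xz _ _ _ ⟩
        f α a ∙ (f γ (coeff F γ) ∙ linear f (normalForm Γ F)) ∎
        where open CommutativeSemigroupProperties commutativeSemigroup using (x∙yz≈y∙xz)

      linear-normalForm : ∀ {Γ} → Unique Γ → ∀ F → (∀ {α} → α ∈ exponents F → α ∈ Γ) →
        linear f F ≈ linear f (normalForm Γ F)
      linear-normalForm {Γ} Γ! []            F⊆Γ = sym (normalForm-[] Γ)
      linear-normalForm Γ! ((a , α) ∷ F) F⊆Γ = trans
        (∙-congˡ (linear-normalForm Γ! F (F⊆Γ ∘ there)))
        (sym (normalForm-∷ a α F Γ! (F⊆Γ (here ≡.refl))))

      normalForm-cong : ∀ Γ {F G} → F ≈ₚ G → linear f (normalForm Γ F) ≈ linear f (normalForm Γ G)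
      normalForm-cong []      F≈G = refl
      normalForm-cong (α ∷ Γ) {F} {G} F≈G = ∙-cong (⟦⟧-cong α (F≈G α)) (normalForm-cong Γ {F} {G} F≈G)

    -- Both polynomials are rewritten over one duplicate-free list containing the exponents of both;
    -- the two sums then agree term by term.
    linear-resp-≈ₚ : ∀ {F G} → F ≈ₚ G → linear f F ≈ linear f G
    linear-resp-≈ₚ {F} {G} F≈G = begin
      linear f F                ≈⟨ linear-normalForm Γ! F (∈.∈-deduplicate⁺ _≟ᵛ_ ∘ ∈.∈-++⁺ˡ) ⟩
      linear f (normalForm Γ F) ≈⟨ normalForm-cong Γ {F} {G} F≈G ⟩
      linear f (normalForm Γ G) ≈⟨ linear-normalForm Γ! G (∈.∈-deduplicate⁺ _≟ᵛ_ ∘ ∈.∈-++⁺ʳ (exponents F)) ⟨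
      linear f G                ∎
      where
      Γ = List.deduplicate _≟ᵛ_ (exponents F ++ exponents G)
      Γ! = Unique.deduplicate-! _≟ᵛ_ (exponents F ++ exponents G)

  open Additive public using (linear-resp-≈ₚ)

-- The semiring of polynomials

⊕-assoc : ∀ (α β γ : Vec ℕ n) → (α ⊕ β) ⊕ γ ≡ α ⊕ (β ⊕ γ)
⊕-assoc = Vec.zipWith-assoc ℕ.+-assoc

⊕-comm : ∀ (α β : Vec ℕ n) → α ⊕ β ≡ β ⊕ α
⊕-comm = Vec.zipWith-comm ℕ.+-comm

⊕-identityˡ : ∀ (α : Vec ℕ n) → Vec.replicate n 0 ⊕ α ≡ α
⊕-identityˡ = Vec.zipWith-identityˡ ℕ.+-identityˡ

mkMonoidHomomorphism : ∀ {a b ℓᵃ ℓᵇ} {A : RawMonoid a ℓᵃ} {B : RawMonoid b ℓᵇ} → let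
  module A = RawMonoid A
  module B = RawMonoid B in
  {h : A.Carrier → B.Carrier} → (∀ {x y} → x A.≈ y → h x B.≈ h y) →
  (∀ x y → h (x A.∙ y) B.≈ h x B.∙ h y) → h A.ε B.≈ B.ε → MonoidMorphisms.IsMonoidHomomorphism A B h
mkMonoidHomomorphism cong homo ε-homo = record
  { isMagmaHomomorphism = record { isRelHomomorphism = record { cong = cong } ; homo = homo } ; ε-homo = ε-homo }

module PolynomialSemiring {c ℓ} (R : CommutativeRing c ℓ) where
  open CommutativeRing R hiding (zero)
  open Polynomials R using (coeff; constant; _*ₚ_; _≈ₚ_)
  open LinearExtension R +-commutativeMonoid
  open MonoidMorphisms +-rawMonoid +-rawMonoid using (IsMonoidHomomorphism)
  open import Relation.Binary.Reasoning.Setoid setoid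

  -- Unlike _≈ₚ_, this relation lets its two sides be inferred from a proof.
  infix 4 _≃_
  record _≃_ {n} (F G : Poly R n) : Set ℓ where
    constructor coefficientwise
    field coefficients : F ≈ₚ G
  open _≃_ public

  private
    select : Vec ℕ n → Vec ℕ n → Carrier → Carrier
    select α β a = if does (α ≟ᵛ β) then a else 0#

    coeff-linear : ∀ (F : Poly R n) α → coeff F α ≡ linear (select α) F
    coeff-linear []            α = ≡.refl
    coeff-linear ((a , β) ∷ F) α = ≡.cong₂ _+_ ≡.refl (coeff-linear F α)

    select-additive : ∀ (α : Vec ℕ n) → IsAdditive (select α)
    select-additive α β with α ≟ᵛ β
    ... | yes _ = mkMonoidHomomorphism id (λ _ _ → refl) refl
    ... | no  _ = mkMonoidHomomorphism (λ _ → refl) (λ _ _ → sym (+-identityˡ 0#)) refl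

  coeff-∉ : ∀ (F : Poly R n) {α} → α ∉ exponents F → coeff F α ≈ 0#
  coeff-∉ []            α∉F = refl
  coeff-∉ ((a , β) ∷ F) {α} α∉F with α ≟ᵛ β
  ... | yes α≡β = contradiction (here α≡β) α∉F
  ... | no  _   = trans (+-identityˡ _) (coeff-∉ F (α∉F ∘ there))

  -- Reading off a coefficient is itself additive, so functionals separate polynomials. The semiring
  -- laws thereby become rearrangements of finite sums.
  ≃-from-linear : ∀ {F G : Poly R n} → (∀ {f} → IsAdditive f → linear f F ≈ linear f G) → F ≃ G
  ≃-from-linear {F = F} {G} F≈G = coefficientwise λ α →
    ≡.subst₂ _≈_ (≡.sym (coeff-linear F α)) (≡.sym (coeff-linear G α)) (F≈G (select-additive α))

  ≃-to-linear : ∀ {F G : Poly R n} {f} → F ≃ G → IsAdditive f → linear f F ≈ linear f G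
  ≃-to-linear {F = F} {G} F≃G f-additive = linear-resp-≈ₚ _ f-additive {F} {G} (coefficients F≃G)

  private
    -- the functional G ↦ f (a·x^α·G)
    shift : (Vec ℕ n → Carrier → Carrier) → Vec ℕ n → Carrier → Vec ℕ n → Carrier → Carrier
    shift f α a β b = f (α ⊕ β) (a * b)

    shift-additive : ∀ {f : Vec ℕ n → Carrier → Carrier} → IsAdditive f → ∀ α a → IsAdditive (shift f α a)
    shift-additive f-additive α a β = mkMonoidHomomorphism
      (λ b≈b′ → ⟦⟧-cong (*-congˡ b≈b′))
      (λ b b′ → trans (⟦⟧-cong (distribˡ a b b′)) (homo _ _))
      (trans (⟦⟧-cong (zeroʳ a)) ε-homo)
      where open IsMonoidHomomorphism (f-additive (α ⊕ β))

    -- In `*ₚ-cong` the second factor is absorbed into the functional applied to the first, and this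
    -- functional has to be additive again.
    linear-shift-additive : ∀ {f : Vec ℕ n → Carrier → Carrier} → IsAdditive f → ∀ G → IsAdditive (λ α a → linear (shift f α a) G)
    linear-shift-additive f-additive G α = mkMonoidHomomorphism
      (λ a≈a′ → linear-cong (λ β b → ⟦⟧-cong β (*-congʳ a≈a′)) G)
      (λ a a′ → trans (linear-cong (λ β b → trans (⟦⟧-cong β (distribʳ b a a′)) (homo β _ _)) G) (linear-∙ _ _ G))
      (trans (linear-cong (λ β b → trans (⟦⟧-cong β (zeroˡ b)) (ε-homo β)) G) (linear-ε G))
      where open module Homo β = IsMonoidHomomorphism (f-additive (α ⊕ β))

  ++-cong : ∀ {F F′ G G′ : Poly R n} → F ≃ F′ → G ≃ G′ → F ++ G ≃ F′ ++ G′
  ++-cong {F = F} {F′} {G} {G′} F≃F′ G≃G′ = ≃-from-linear λ {f} f+ → begin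
    linear f (F ++ G)           ≈⟨ linear-++ f F G ⟩
    linear f F + linear f G     ≈⟨ +-cong (≃-to-linear F≃F′ f+) (≃-to-linear G≃G′ f+) ⟩
    linear f F′ + linear f G′   ≈⟨ linear-++ f F′ G′ ⟨
    linear f (F′ ++ G′)         ∎

  ++-comm : ∀ (F G : Poly R n) → F ++ G ≃ G ++ F
  ++-comm F G = ≃-from-linear λ {f} f+ → begin
    linear f (F ++ G)         ≈⟨ linear-++ f F G ⟩
    linear f F + linear f G   ≈⟨ +-comm _ _ ⟩
    linear f G + linear f F   ≈⟨ linear-++ f G F ⟨
    linear f (G ++ F)         ∎

  *ₚ-cong : ∀ {F F′ G G′ : Poly R n} → F ≃ F′ → G ≃ G′ → F *ₚ G ≃ F′ *ₚ G′
  *ₚ-cong {F = F} {F′} {G} {G′} F≃F′ G≃G′ = ≃-from-linear λ {f} f+ → begin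
    linear f (F *ₚ G)                                ≈⟨ linear-*ₚ f F G ⟩
    linear (λ α a → linear (shift f α a) G) F        ≈⟨ linear-cong (λ α a → ≃-to-linear G≃G′ (shift-additive f+ α a)) F ⟩
    linear (λ α a → linear (shift f α a) G′) F       ≈⟨ ≃-to-linear F≃F′ (linear-shift-additive f+ G′) ⟩
    linear (λ α a → linear (shift f α a) G′) F′      ≈⟨ linear-*ₚ f F′ G′ ⟨
    linear f (F′ *ₚ G′)                              ∎

  *ₚ-comm : ∀ (F G : Poly R n) → F *ₚ G ≃ G *ₚ F
  *ₚ-comm F G = ≃-from-linear λ {f} f+ → begin
    linear f (F *ₚ G)                                       ≈⟨ linear-*ₚ f F G ⟩
    linear (λ α a → linear (shift f α a) G) F               ≈⟨ linear-swap (shift f) F G ⟩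
    linear (λ β b → linear (λ α a → shift f α a β b) F) G
      ≈⟨ linear-cong (λ β b → linear-cong (λ α a → commute f+ α a β b) F) G ⟩
    linear (λ β b → linear (shift f β b) F) G               ≈⟨ linear-*ₚ f G F ⟨
    linear f (G *ₚ F)                                       ∎
    where
    commute : ∀ {f : Vec ℕ n → Carrier → Carrier} → IsAdditive f → ∀ α a β b → f (α ⊕ β) (a * b) ≈ f (β ⊕ α) (b * a)
    commute {f = f} f+ α a β b = trans
      (IsMonoidHomomorphism.⟦⟧-cong (f+ (α ⊕ β)) (*-comm a b))
      (reflexive (≡.cong (λ γ → f γ (b * a)) (⊕-comm α β)))

  *ₚ-assoc : ∀ (F G H : Poly R n) → (F *ₚ G) *ₚ H ≃ F *ₚ (G *ₚ H)
  *ₚ-assoc F G H = ≃-from-linear λ {f} f+ → begin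
    linear f ((F *ₚ G) *ₚ H)
      ≈⟨ linear-*ₚ f (F *ₚ G) H ⟩
    linear (λ α a → linear (shift f α a) H) (F *ₚ G)
      ≈⟨ linear-*ₚ (λ α a → linear (shift f α a) H) F G ⟩
    linear (λ α a → linear (λ β b → linear (shift f (α ⊕ β) (a * b)) H) G) F
      ≈⟨ linear-cong (λ α a → linear-cong (λ β b → linear-cong (λ γ c → associate f+ α a β b γ c) H) G) F ⟩
    linear (λ α a → linear (λ β b → linear (λ γ c → f (α ⊕ (β ⊕ γ)) (a * (b * c))) H) G) F
      ≈⟨ linear-cong (λ α a → linear-*ₚ (shift f α a) G H) F ⟨
    linear (λ α a → linear (shift f α a) (G *ₚ H)) F
      ≈⟨ linear-*ₚ f F (G *ₚ H) ⟨
    linear f (F *ₚ (G *ₚ H)) ∎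
    where
    associate : ∀ {f : Vec ℕ n → Carrier → Carrier} → IsAdditive f → ∀ α a β b γ c →
      f ((α ⊕ β) ⊕ γ) ((a * b) * c) ≈ f (α ⊕ (β ⊕ γ)) (a * (b * c))
    associate {f = f} f+ α a β b γ c = trans
      (IsMonoidHomomorphism.⟦⟧-cong (f+ ((α ⊕ β) ⊕ γ)) (*-assoc a b c))
      (reflexive (≡.cong (λ γ → f γ (a * (b * c))) (⊕-assoc α β γ)))

  *ₚ-distribʳ-++ : ∀ (F G H : Poly R n) → (G ++ H) *ₚ F ≃ G *ₚ F ++ H *ₚ F
  *ₚ-distribʳ-++ F G H = ≃-from-linear λ {f} f+ → begin
    linear f ((G ++ H) *ₚ F)                    ≈⟨ linear-*ₚ f (G ++ H) F ⟩
    linear _ (G ++ H)                           ≈⟨ linear-++ _ G H ⟩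
    linear _ G + linear _ H                     ≈⟨ +-cong (linear-*ₚ f G F) (linear-*ₚ f H F) ⟨
    linear f (G *ₚ F) + linear f (H *ₚ F)       ≈⟨ linear-++ f (G *ₚ F) (H *ₚ F) ⟨
    linear f (G *ₚ F ++ H *ₚ F)                 ∎

  *ₚ-identityˡ : ∀ (F : Poly R n) → constant 1# *ₚ F ≃ F
  *ₚ-identityˡ F = ≃-from-linear λ {f} f+ → begin
    linear f (constant 1# *ₚ F)          ≈⟨ linear-*ₚ f (constant 1#) F ⟩
    linear (shift f (Vec.replicate _ 0) 1#) F + 0#   ≈⟨ +-identityʳ _ ⟩
    linear (shift f (Vec.replicate _ 0) 1#) F        ≈⟨ linear-cong (λ α a → trans
        (IsMonoidHomomorphism.⟦⟧-cong (f+ _) (*-identityˡ a))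
        (reflexive (≡.cong (λ γ → f γ a) (⊕-identityˡ α)))) F ⟩
    linear f F                           ∎

  -- Makes polynomials a possible target of evaluation, so that substitution becomes a special case
  -- of it.
  polynomials : ℕ → CommutativeSemiring c ℓ
  polynomials n = record
    { Carrier = Poly R n
    ; _≈_ = _≃_
    ; _+_ = _++_
    ; _*_ = _*ₚ_
    ; 0# = []
    ; 1# = constant 1#
    ; isCommutativeSemiring = isCommutativeSemiringˡ record
      { +-isCommutativeMonoid = isCommutativeMonoidˡ record
        { isSemigroup = record
          { isMagma = record { isEquivalence = ≃-isEquivalence ; ∙-cong = ++-cong }
          ; assoc = λ F G H → ≃-reflexive (List.++-assoc F G H) }
        ; identityˡ = λ _ → ≃-reflexive ≡.refl
        ; comm = ++-comm }
      ; *-isCommutativeMonoid = isCommutativeMonoidˡ record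
        { isSemigroup = record
          { isMagma = record { isEquivalence = ≃-isEquivalence ; ∙-cong = *ₚ-cong }
          ; assoc = *ₚ-assoc }
        ; identityˡ = *ₚ-identityˡ
        ; comm = *ₚ-comm }
      ; distribʳ = *ₚ-distribʳ-++
      ; zeroˡ = λ _ → ≃-reflexive ≡.refl }
    }
    where
    ≃-reflexive : ∀ {F G : Poly R n} → F ≡ G → F ≃ G
    ≃-reflexive ≡.refl = coefficientwise λ _ → refl
    ≃-isEquivalence : IsEquivalence (_≃_ {n})
    ≃-isEquivalence = record
      { refl = ≃-reflexive ≡.refl
      ; sym = λ F≃G → coefficientwise λ α → sym (coefficients F≃G α)
      ; trans = λ F≃G G≃H → coefficientwise λ α → trans (coefficients F≃G α) (coefficients G≃H α) }

-- Evaluation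

mkSemiringHomomorphism : ∀ {a b ℓᵃ ℓᵇ} {A : RawSemiring a ℓᵃ} {B : RawSemiring b ℓᵇ} → let
  module A = RawSemiring A
  module B = RawSemiring B in
  {h : A.Carrier → B.Carrier} → (∀ {x y} → x A.≈ y → h x B.≈ h y) →
  (∀ x y → h (x A.+ y) B.≈ h x B.+ h y) → h A.0# B.≈ B.0# →
  (∀ x y → h (x A.* y) B.≈ h x B.* h y) → h A.1# B.≈ B.1# → SemiringMorphisms.IsSemiringHomomorphism A B h
mkSemiringHomomorphism cong +-homo 0#-homo *-homo 1#-homo = record
  { isNearSemiringHomomorphism = record
    { +-isMonoidHomomorphism = mkMonoidHomomorphism cong +-homo 0#-homo ; *-homo = *-homo }
  ; 1#-homo = 1#-homo }

module _ {a b ℓᵃ ℓᵇ} (A : CommutativeSemiring a ℓᵃ) (B : CommutativeSemiring b ℓᵇ) where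
  private
    module A = CommutativeSemiring A
    module B = CommutativeSemiring B

  open SemiringMorphisms A.rawSemiring B.rawSemiring public using ()
    renaming (IsSemiringHomomorphism to IsHomomorphism)

module Homomorphism {a b ℓᵃ ℓᵇ} {A : CommutativeSemiring a ℓᵃ} {B : CommutativeSemiring b ℓᵇ}
  {h : CommutativeSemiring.Carrier A → CommutativeSemiring.Carrier B} (h-homo : IsHomomorphism A B h) where
  private
    module A where
      open CommutativeSemiring A public
      open RawSemiringDefinitions rawSemiring public using (sum; product; _^_)
    module B where
      open CommutativeSemiring B public
      open RawSemiringDefinitions rawSemiring public using (sum; product; _^_)

  open SemiringMorphisms.IsSemiringHomomorphism h-homo public using (⟦⟧-cong; +-homo; 0#-homo; *-homo; 1#-homo)

  sum-homo : ∀ (x : Vector A.Carrier n) → h (A.sum x) B.≈ B.sum (h ∘ x)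
  sum-homo {zero}  x = 0#-homo
  sum-homo {suc n} x = B.trans (+-homo _ _) (B.+-congˡ (sum-homo (x ∘ suc)))

  product-homo : ∀ (x : Vector A.Carrier n) → h (A.product x) B.≈ B.product (h ∘ x)
  product-homo {zero}  x = 1#-homo
  product-homo {suc n} x = B.trans (*-homo _ _) (B.*-congˡ (product-homo (x ∘ suc)))

  ^-homo : ∀ x k → h (x A.^ k) B.≈ h x B.^ k
  ^-homo x zero    = 1#-homo
  ^-homo x (suc k) = B.trans (*-homo _ _) (B.*-congˡ (^-homo x k))

unit : Fin n → Vec ℕ n
unit i = Vec.replicate _ 0 [ i ]≔ 1

module Monomials {s ℓˢ} (S : CommutativeSemiring s ℓˢ) where
  open CommutativeSemiring S hiding (zero)
  open RawSemiringDefinitions rawSemiring using (product; _^_)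
  private module ∏ = MonoidSum *-commutativeMonoid
  open SemiringExp semiring using (^-homo-*; ^-congˡ)

  monomial : Vector Carrier n → Vec ℕ n → Carrier
  monomial x α = product λ i → x i ^ Vec.lookup α i

  monomial-cong : ∀ {x y : Vector Carrier n} → (∀ i → x i ≈ y i) → ∀ α → monomial x α ≈ monomial y α
  monomial-cong x≈y α = ∏.sum-cong-≋ λ i → ^-congˡ (Vec.lookup α i) (x≈y i)

  monomial-⊕ : ∀ (x : Vector Carrier n) α β → monomial x (α ⊕ β) ≈ monomial x α * monomial x β
  monomial-⊕ x []      []      = sym (*-identityˡ 1#)
  monomial-⊕ x (a ∷ α) (b ∷ β) = trans
    (*-cong (^-homo-* (x zero) a b) (monomial-⊕ (x ∘ suc) α β))
    (interchange _ _ _ _)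
    where open CommutativeSemigroupProperties *-commutativeSemigroup using (interchange)

  monomial-0 : ∀ (x : Vector Carrier n) → monomial x (Vec.replicate n 0) ≈ 1#
  monomial-0 {zero}  x = refl
  monomial-0 {suc n} x = trans (*-identityˡ _) (monomial-0 (x ∘ suc))

  monomial-unit : ∀ (x : Vector Carrier n) i → monomial x (unit i) ≈ x i
  monomial-unit x zero    = trans (*-cong (*-identityʳ _) (monomial-0 (x ∘ suc))) (*-identityʳ _)
  monomial-unit x (suc i) = trans (*-identityˡ _) (monomial-unit (x ∘ suc) i)

module Evaluation {c ℓ s ℓˢ} (R : CommutativeRing c ℓ) (S : CommutativeSemiring s ℓˢ) where
  private module R = CommutativeRing R
  open CommutativeSemiring S hiding (zero)
  open RawSemiringDefinitions rawSemiring using (sum)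
  open Polynomials R using (constant; _*ₚ_; linearForm)
  open PolynomialSemiring R using (polynomials; coefficients; _≃_)
  open LinearExtension R +-commutativeMonoid
  open Monomials S

  -- The coefficient map is a parameter: `constant` gives substitution, and composing it with a
  -- homomorphism absorbs base change.
  eval : (R.Carrier → Carrier) → Vector Carrier n → Poly R n → Carrier
  eval ι x = linear λ α a → ι a * monomial x α

  eval-cong : ∀ {ι κ : R.Carrier → Carrier} {x y : Vector Carrier n} →
    (∀ a → ι a ≈ κ a) → (∀ i → x i ≈ y i) → ∀ F → eval ι x F ≈ eval κ y F
  eval-cong ι≈κ x≈y = linear-cong λ α a → *-cong (ι≈κ a) (monomial-cong x≈y α)

  module _ {ι : R.Carrier → Carrier} (ι-homo : IsHomomorphism R.commutativeSemiring S ι) (x : Vector Carrier n) where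
    open Homomorphism {A = R.commutativeSemiring} {B = S} ι-homo
    private module Sum = MonoidSum +-commutativeMonoid

    private
      term-additive : IsAdditive {n = n} (λ α a → ι a * monomial x α)
      term-additive α = mkMonoidHomomorphism
        (λ a≈b → *-congʳ (⟦⟧-cong a≈b))
        (λ a b → trans (*-congʳ (+-homo a b)) (distribʳ _ _ _))
        (trans (*-congʳ 0#-homo) (zeroˡ _))

    eval-resp-≃ : ∀ {F G} → F ≃ G → eval ι x F ≈ eval ι x G
    eval-resp-≃ {F} {G} F≃G = linear-resp-≈ₚ _ term-additive {F} {G} (coefficients F≃G)

    eval-constant : ∀ a → eval ι x (constant a) ≈ ι a
    eval-constant a = trans (+-identityʳ _) (trans (*-congˡ (monomial-0 x)) (*-identityʳ _))

    eval-linearForm : ∀ a → eval ι x (linearForm a) ≈ sum λ j → ι (a j) * x j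
    eval-linearForm a = trans (reflexive (linear-tabulate {k = n} _ (λ j → a j , unit j)))
      (Sum.sum-cong-≋ λ j → *-congˡ (monomial-unit x j))

    private
      eval-scale : ∀ a α G → eval ι x (List.map (λ where (b , β) → a R.* b , α ⊕ β) G) ≈ (ι a * monomial x α) * eval ι x G
      eval-scale a α []            = sym (zeroʳ _)
      eval-scale a α ((b , β) ∷ G) = trans
        (+-cong (trans (*-cong (*-homo a b) (monomial-⊕ x α β)) (interchange _ _ _ _)) (eval-scale a α G))
        (sym (distribˡ _ _ _))
        where open CommutativeSemigroupProperties *-commutativeSemigroup using (interchange)

    eval-*ₚ : ∀ F G → eval ι x (F *ₚ G) ≈ eval ι x F * eval ι x G
    eval-*ₚ []            G = sym (zeroˡ _)
    eval-*ₚ ((a , α) ∷ F) G = trans (linear-++ _ (List.map _ G) (F *ₚ G))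
      (trans (+-cong (eval-scale a α G) (eval-*ₚ F G)) (sym (distribʳ _ _ _)))

    eval-homo : IsHomomorphism (polynomials n) S (eval ι x)
    eval-homo = mkSemiringHomomorphism eval-resp-≃ (linear-++ _) refl eval-*ₚ
      (trans (eval-constant R.1#) 1#-homo)

module _ {c ℓ s t ℓˢ ℓᵗ} (R : CommutativeRing c ℓ) {S : CommutativeSemiring s ℓˢ} {T : CommutativeSemiring t ℓᵗ} where
  private
    module R = CommutativeRing R
    module S where
      open CommutativeSemiring S public
      open Evaluation R S public
      open Monomials S public
    module T where
      open CommutativeSemiring T public
      open Evaluation R T public
      open Monomials T public
      open MonoidSum *-commutativeMonoid public

  -- Evaluation uses only sums, products and powers, which `h` preserves. With `h` itself an
  -- evaluation, this is the rule for composing substitutions.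
  homo-eval : ∀ {n h} → IsHomomorphism S T h → ∀ (ι : R.Carrier → S.Carrier) (x : Vector S.Carrier n) F →
    h (S.eval ι x F) T.≈ T.eval (h ∘ ι) (h ∘ x) F
  homo-eval {h = h} h-homo ι x []            = Homomorphism.0#-homo {A = S} {B = T} h-homo
  homo-eval {n} {h} h-homo ι x ((a , α) ∷ F) = T.trans (+-homo _ _)
    (T.+-cong (T.trans (*-homo _ _) (T.*-congˡ homo-monomial)) (homo-eval h-homo ι x F))
    where
    open Homomorphism {A = S} {B = T} h-homo
    homo-monomial : h (S.monomial x α) T.≈ T.monomial (h ∘ x) α
    homo-monomial = T.trans (product-homo {n} _) (T.sum-cong-≋ λ i → ^-homo (x i) (Vec.lookup α i))

-- Linear changes of variables

module SemiringSums {s ℓˢ} (S : CommutativeSemiring s ℓˢ) where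
  open CommutativeSemiring S hiding (zero)
  open MonoidSum +-commutativeMonoid public
  open SemiringSum semiring using (*-distribˡ-sum; *-distribʳ-sum)
  open import Relation.Binary.Reasoning.Setoid setoid

  δ : Fin n → Fin n → Carrier
  δ i j = if does (i Fin.≟ j) then 1# else 0#

  δ-diagonal : ∀ (i : Fin n) → δ i i ≡ 1#
  δ-diagonal i = ≡.cong (λ b → if b then 1# else 0#) (dec-true (i Fin.≟ i) ≡.refl)

  δ-off-diagonal : ∀ {i j : Fin n} → i ≢ j → δ i j ≡ 0#
  δ-off-diagonal {i = i} {j} i≢j = ≡.cong (λ b → if b then 1# else 0#) (dec-false (i Fin.≟ j) i≢j)

  sum-zero : ∀ {x : Vector Carrier n} → (∀ i → x i ≈ 0#) → sum x ≈ 0#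
  sum-zero {n} x≈0 = trans (sum-cong-≋ x≈0) (sum-replicate-zero n)

  sum-single : ∀ (i : Fin n) (x : Vector Carrier n) → (∀ j → j ≢ i → x j ≈ 0#) → sum x ≈ x i
  sum-single {suc n} i x x≈0 = trans (sum-remove {i = i} x)
    (trans (+-congˡ (sum-zero λ j → x≈0 (punchIn i j) (Fin.punchInᵢ≢i i j))) (+-identityʳ _))

  sum-δˡ : ∀ (i : Fin n) (x : Vector Carrier n) → sum (λ j → δ i j * x j) ≈ x i
  sum-δˡ i x = trans
    (sum-single i _ λ j j≢i → trans (*-congʳ (reflexive (δ-off-diagonal (j≢i ∘ ≡.sym)))) (zeroˡ _))
    (trans (*-congʳ (reflexive (δ-diagonal i))) (*-identityˡ _))

  -- Associativity of row times matrix times column, the reason that linear substitutions compose.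
  sum-assoc : ∀ {m} (x : Vector Carrier m) (A : Fin m → Fin n → Carrier) (y : Vector Carrier n) →
    sum (λ i → x i * sum (λ j → A i j * y j)) ≈ sum (λ j → sum (λ i → x i * A i j) * y j)
  sum-assoc {n} {m} x A y = begin
    sum (λ i → x i * sum (λ j → A i j * y j))    ≈⟨ sum-cong-≋ {m} (λ i → *-distribˡ-sum {n} (x i) _) ⟩
    sum (λ i → sum (λ j → x i * (A i j * y j)))  ≈⟨ ∑-comm {m} {n} _ ⟩
    sum (λ j → sum (λ i → x i * (A i j * y j)))  ≈⟨ sum-cong-≋ {n} (λ j → sum-cong-≋ {m} λ i → sym (*-assoc _ _ _)) ⟩
    sum (λ j → sum (λ i → x i * A i j * y j))    ≈⟨ sum-cong-≋ {n} (λ j → sym (*-distribʳ-sum {m} (y j) (λ i → x i * A i j))) ⟩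
    sum (λ j → sum (λ i → x i * A i j) * y j)    ∎

module Variables {c ℓ} (R : CommutativeRing c ℓ) where
  private module R = CommutativeRing R
  open Polynomials R using (constant; _*ₚ_; _^ₚ_; linearForm; substitute; changeVariables; Matrix; identity; _·_; _≈ₘ_)
  open PolynomialSemiring R
  open MonoidMorphisms R.+-rawMonoid R.+-rawMonoid using (IsMonoidHomomorphism)

  term : R.Carrier → Vec ℕ n → Poly R n
  term a α = (a , α) ∷ []

  term-cong : ∀ {a b} {α β : Vec ℕ n} → a R.≈ b → α ≡ β → term a α ≃ term b β
  term-cong a≈b ≡.refl = ≃-from-linear λ f+ → R.+-congʳ (IsMonoidHomomorphism.⟦⟧-cong (f+ _) a≈b)

  constant-homo : IsHomomorphism R.commutativeSemiring (polynomials n) constant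
  constant-homo = mkSemiringHomomorphism
    (λ a≈b → term-cong a≈b ≡.refl)
    (λ a b → ≃-from-linear λ f+ → R.trans (R.+-congʳ (IsMonoidHomomorphism.homo (f+ _) a b)) (R.+-assoc _ _ _))
    (≃-from-linear λ f+ → R.trans (R.+-identityʳ _) (IsMonoidHomomorphism.ε-homo (f+ _)))
    (λ a b → term-cong R.refl (≡.sym (⊕-identityˡ _)))
    (term-cong R.refl ≡.refl)

  variables : Vector (Poly R n) n
  variables i = term R.1# (unit i)

  module _ {n : ℕ} where
    open CommutativeSemiring (polynomials n) using (sym; trans; refl; *-congˡ; +-cong; rawSemiring)
    open RawSemiringDefinitions rawSemiring using (product; sum; _^_)
    open Monomials (polynomials n) using (monomial)
    open Evaluation R (polynomials n) using (eval)
    open MonoidSum (CommutativeSemiring.*-commutativeMonoid (polynomials n)) using (sum-cong-≋; sum-cong-≗)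

    private
      zeros : ∀ {k} (i : Fin k) → Vec.replicate k 0 ≡ Vec.replicate k 0 [ i ]≔ 0
      zeros zero    = ≡.refl
      zeros (suc i) = ≡.cong (0 ∷_) (zeros i)

      unit-⊕ : ∀ {k} (i : Fin k) a → unit i ⊕ (Vec.replicate k 0 [ i ]≔ a) ≡ Vec.replicate k 0 [ i ]≔ suc a
      unit-⊕ zero    a = ≡.cong (_ ∷_) (⊕-identityˡ _)
      unit-⊕ (suc i) a = ≡.cong (0 ∷_) (unit-⊕ i a)

      ∑-0∷ : ∀ {m k} (β : Vector (Vec ℕ k) m) →
        Vector.foldr _⊕_ (Vec.replicate (suc k) 0) (λ i → 0 ∷ β i) ≡ 0 ∷ Vector.foldr _⊕_ (Vec.replicate k 0) β
      ∑-0∷ {zero}  β = ≡.refl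
      ∑-0∷ {suc m} β = ≡.cong ((0 ∷ β zero) ⊕_) (∑-0∷ (β ∘ suc))

      ∑-axes : ∀ {k} (α : Vec ℕ k) →
        Vector.foldr _⊕_ (Vec.replicate k 0) (λ i → Vec.replicate k 0 [ i ]≔ Vec.lookup α i) ≡ α
      ∑-axes []      = ≡.refl
      ∑-axes (a ∷ α) = ≡.trans (≡.cong ((a ∷ _) ⊕_)
          (≡.trans (∑-0∷ λ i → Vec.replicate _ 0 [ i ]≔ Vec.lookup α i) (≡.cong (0 ∷_) (∑-axes α))))
        (≡.cong₂ _∷_ (ℕ.+-identityʳ a) (⊕-identityˡ α))

    variable-^ : ∀ (i : Fin n) k → variables i ^ k ≃ term R.1# (Vec.replicate n 0 [ i ]≔ k)
    variable-^ i zero    = term-cong R.refl (zeros i)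
    variable-^ i (suc k) = trans (*-congˡ {x = variables i} (variable-^ i k)) (term-cong (R.*-identityˡ _) (unit-⊕ i k))

    product-terms : ∀ {m} (β : Vector (Vec ℕ n) m) →
      product (λ i → term R.1# (β i)) ≃ term R.1# (Vector.foldr _⊕_ (Vec.replicate n 0) β)
    product-terms {zero}  β = refl
    product-terms {suc m} β = trans (*-congˡ {x = term _ _} (product-terms (β ∘ suc))) (term-cong (R.*-identityˡ _) ≡.refl)

    monomial-variables : ∀ α → monomial variables α ≃ term R.1# α
    monomial-variables α = trans (sum-cong-≋ {n} λ i → variable-^ i (Vec.lookup α i))
      (trans (product-terms {n} _) (term-cong R.refl (∑-axes α)))

    -- As every polynomial is its own value at the variables, facts about evaluation at arbitrary
    -- points specialise to identities of polynomials.
    eval-variables : ∀ F → eval constant variables F ≃ F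
    eval-variables []            = refl
    eval-variables ((a , α) ∷ F) = +-cong {constant a *ₚ monomial variables α} {term a α} {eval constant variables F} {F}
      (trans (*-congˡ {x = constant a} (monomial-variables α)) (term-cong (R.*-identityʳ a) (⊕-identityˡ α)))
      (eval-variables F)

    linearForm-variables : ∀ a → linearForm a ≃ sum λ j → constant (a j) *ₚ variables j
    linearForm-variables a = trans (sym (eval-variables (linearForm a)))
      (Evaluation.eval-linearForm R (polynomials n) constant-homo variables a)

    private
      ^ₚ-^ : ∀ F k → F ^ₚ k ≡ F ^ k
      ^ₚ-^ F zero    = ≡.refl
      ^ₚ-^ F (suc k) = ≡.cong (F *ₚ_) (^ₚ-^ F k)

    -- The two sides differ only in their copy of exponentiation, so `substitute` inherits all that
    -- is proved of `eval`.
    substitute-eval : ∀ {m} F (L : Vector (Poly R n) m) → substitute F L ≡ eval constant L F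
    substitute-eval []            L = ≡.refl
    substitute-eval ((a , α) ∷ F) L = ≡.cong₂ _++_
      (≡.cong (constant a *ₚ_) (sum-cong-≗ λ i → ^ₚ-^ (L i) (Vec.lookup α i)))
      (substitute-eval F L)

  module _ {s ℓˢ} {S : CommutativeSemiring s ℓˢ} {ι : R.Carrier → CommutativeSemiring.Carrier S}
    (ι-homo : IsHomomorphism R.commutativeSemiring S ι) where
    open CommutativeSemiring S hiding (zero)
    open SemiringSums S
    open Evaluation R S
    open Homomorphism {A = R.commutativeSemiring} {B = S} ι-homo

    -- `eval ι x` is a homomorphism on polynomials, so `homo-eval` applies to it and moves the
    -- matrix from the polynomial to the point.
    eval-changeVariables : ∀ (x : Vector Carrier n) A F →
      eval ι x (changeVariables A F) ≈ eval ι (λ i → sum λ j → ι (A i j) * x j) F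
    eval-changeVariables x A F = trans
      (reflexive (≡.cong (eval ι x) (substitute-eval F _)))
      (trans (homo-eval R {S = polynomials _} {T = S} (eval-homo ι-homo x) constant _ F)
        (eval-cong (eval-constant ι-homo x) (λ i → eval-linearForm ι-homo x (A i)) F))

    ι-δ : ∀ (i j : Fin n) → ι (identity i j) ≈ δ i j
    ι-δ i j with does (i Fin.≟ j)
    ... | true  = 1#-homo
    ... | false = 0#-homo

    linear-combination-inverse : ∀ {A B : Matrix n} → A · B ≈ₘ identity → ∀ (x : Vector Carrier n) i →
      sum (λ j → ι (A i j) * sum λ k → ι (B j k) * x k) ≈ x i
    linear-combination-inverse {n} {A} {B} AB≈1 x i = trans (sum-assoc {n} {n} _ _ _)
      (trans (sum-cong-≋ {n} λ k → *-congʳ (trans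
          (sum-cong-≋ {n} λ j → sym (*-homo (A i j) (B j k)))
          (trans (sym (sum-homo {n} _)) (trans (⟦⟧-cong (AB≈1 i k)) (ι-δ i k)))))
        (sum-δˡ i x))

  -- Serves for cancellation: a polynomial whose transform by `A` vanishes must vanish.
  changeVariables-inverse : ∀ {A B : Matrix n} → A · B ≈ₘ identity → ∀ F →
    Evaluation.eval R (polynomials n) constant (λ i → linearForm (B i)) (changeVariables A F) ≃ F
  changeVariables-inverse {n} {A} {B} AB≈1 F = trans (eval-changeVariables {S = polynomials n} constant-homo _ A F)
    (trans (eval-cong {ι = constant} {κ = constant} (λ _ → refl) (λ i → trans
        (sum-cong-≋ {n} λ j → *-congˡ {x = constant (A i j)} (linearForm-variables (B j)))
        (linear-combination-inverse {S = polynomials n} constant-homo AB≈1 variables i)) F)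
      (eval-variables F))
    where
    open CommutativeSemiring (polynomials n) using (refl; trans; *-congˡ)
    open SemiringSums (polynomials n)
    open Evaluation R (polynomials n)

module BaseChange {r ℓʳ k ℓᵏ} {R : CommutativeRing r ℓʳ} {K : CommutativeRing k ℓᵏ}
  (f : CommutativeRing.Carrier R → CommutativeRing.Carrier K)
  (f-homo : IsHomomorphism (CommutativeRing.commutativeSemiring R) (CommutativeRing.commutativeSemiring K) f) where
  private
    module R = CommutativeRing R
    module K = CommutativeRing K
    module R[x] where
      open Polynomials R public
      open Variables R public
    module K[x] where
      open Polynomials K public
      open PolynomialSemiring K public
      open Variables K public
  open Homomorphism {A = R.commutativeSemiring} {B = K.commutativeSemiring} f-homo

  baseChange : Poly R n → Poly K n
  baseChange = List.map (map₁ f)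

  coeff-baseChange : ∀ (F : Poly R n) α → K[x].coeff (baseChange F) α K.≈ f (R[x].coeff F α)
  coeff-baseChange []            α = K.sym 0#-homo
  coeff-baseChange ((a , β) ∷ F) α with does (α ≟ᵛ β)
  ... | true  = K.trans (K.+-congˡ (coeff-baseChange F α)) (K.sym (+-homo _ _))
  ... | false = K.trans (K.+-cong (K.sym 0#-homo) (coeff-baseChange F α)) (K.sym (+-homo _ _))

  eval-baseChange : ∀ {s ℓˢ} (S : CommutativeSemiring s ℓˢ) ι x (F : Poly R n) →
    Evaluation.eval K S ι x (baseChange F) ≡ Evaluation.eval R S (ι ∘ f) x F
  eval-baseChange S ι x []      = ≡.refl
  eval-baseChange S ι x (_ ∷ F) = ≡.cong₂ _+_ ≡.refl (eval-baseChange S ι x F)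
    where open CommutativeSemiring S using (_+_)

  -- Both sides are evaluations over `K` with coefficient map `constant ∘ f`: the left one of `F` at
  -- the linear forms, the right one of its transform at the variables. This transports an
  -- elimination from ℤ to `K`.
  changeVariables-baseChange : ∀ (A : R[x].Matrix n) F →
    K[x].changeVariables (λ i j → f (A i j)) (baseChange F) K[x].≃ baseChange (R[x].changeVariables A F)
  changeVariables-baseChange {n} A F = begin
    K[x].changeVariables (λ i j → f (A i j)) (baseChange F)
      ≡⟨ K[x].substitute-eval (baseChange F) _ ⟩
    Evaluation.eval K K[x]ₙ K[x].constant (λ i → K[x].linearForm (f ∘ A i)) (baseChange F)
      ≡⟨ eval-baseChange K[x]ₙ K[x].constant _ F ⟩
    eval (K[x].constant ∘ f) (λ i → K[x].linearForm (f ∘ A i)) F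
      ≈⟨ eval-cong {ι = K[x].constant ∘ f} {κ = K[x].constant ∘ f} (λ _ → refl) (λ i → K[x].linearForm-variables (f ∘ A i)) F ⟩
    eval (K[x].constant ∘ f) (λ i → sum λ j → K[x].constant (f (A i j)) K[x].*ₚ K[x].variables j) F
      ≈⟨ R[x].eval-changeVariables {S = K[x]ₙ} constant∘f-homo K[x].variables A F ⟨
    eval (K[x].constant ∘ f) K[x].variables (R[x].changeVariables A F)
      ≡⟨ eval-baseChange K[x]ₙ K[x].constant _ (R[x].changeVariables A F) ⟨
    Evaluation.eval K K[x]ₙ K[x].constant K[x].variables (baseChange (R[x].changeVariables A F))
      ≈⟨ K[x].eval-variables _ ⟩
    baseChange (R[x].changeVariables A F) ∎
    where
    K[x]ₙ = K[x].polynomials n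
    open CommutativeSemiring K[x]ₙ using (refl; trans; setoid; rawSemiring)
    open RawSemiringDefinitions rawSemiring using (sum)
    open Evaluation R K[x]ₙ
    open import Relation.Binary.Reasoning.Setoid setoid
    module constant = Homomorphism {A = K.commutativeSemiring} {B = K[x]ₙ} K[x].constant-homo
    constant∘f-homo : IsHomomorphism R.commutativeSemiring K[x]ₙ (K[x].constant ∘ f)
    constant∘f-homo = mkSemiringHomomorphism
      (λ a≈b → constant.⟦⟧-cong (⟦⟧-cong a≈b))
      (λ a b → trans (constant.⟦⟧-cong (+-homo a b)) (constant.+-homo _ _))
      (trans (constant.⟦⟧-cong 0#-homo) constant.0#-homo)
      (λ a b → trans (constant.⟦⟧-cong (*-homo a b)) (constant.*-homo _ _))
      (constant.⟦⟧-cong 1#-homo)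

-- Partial derivatives

raise lower : Fin n → Vec ℕ n → Vec ℕ n
raise i α = α [ i ]%= suc
lower i α = α [ i ]%= ℕ.pred

lookup-raise : ∀ (i : Fin n) α → Vec.lookup (raise i α) i ≡ suc (Vec.lookup α i)
lookup-raise i α = Vec.lookup∘updateAt i α

lower-raise : ∀ (i : Fin n) α → lower i (raise i α) ≡ α
lower-raise zero    (a ∷ α) = ≡.refl
lower-raise (suc i) (a ∷ α) = ≡.cong (a ∷_) (lower-raise i α)

raise-lower : ∀ (i : Fin n) α → Vec.lookup α i ≢ 0 → raise i (lower i α) ≡ α
raise-lower zero    (zero  ∷ α) α≢0 = contradiction ≡.refl α≢0
raise-lower zero    (suc a ∷ α) α≢0 = ≡.refl
raise-lower (suc i) (a ∷ α)     α≢0 = ≡.cong (a ∷_) (raise-lower i α α≢0)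

lower-⊕ : ∀ (i : Fin n) α β → Vec.lookup α i ≢ 0 → lower i α ⊕ β ≡ lower i (α ⊕ β)
lower-⊕ zero    (zero  ∷ α) (b ∷ β) α≢0 = contradiction ≡.refl α≢0
lower-⊕ zero    (suc a ∷ α) (b ∷ β) α≢0 = ≡.refl
lower-⊕ (suc i) (a ∷ α)     (b ∷ β) α≢0 = ≡.cong (_ ∷_) (lower-⊕ i α β α≢0)

lower-unit : ∀ (i : Fin n) → lower i (unit i) ≡ Vec.replicate n 0
lower-unit zero    = ≡.refl
lower-unit (suc i) = ≡.cong (0 ∷_) (lower-unit i)

module ChainRule {c ℓ} (R : CommutativeRing c ℓ) where
  private module R where
    open CommutativeRing R public
    open MonoidMult +-monoid public using (_×_)

  -- At exponent 0 the truncated `lower` gives a wrong exponent, but the coefficient there is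
  -- `0 × a`, so the default is never seen.
  ∂ : Fin n → Poly R n → Poly R n
  ∂ i = List.map λ where (a , α) → Vec.lookup α i R.× a , lower i α

  module _ {s ℓˢ} (S : CommutativeSemiring s ℓˢ) {ι} (ι-homo : IsHomomorphism R.commutativeSemiring S ι) where
    open CommutativeSemiring S hiding (zero)
    open SemiringMult semiring using (_×_; ×-comm-*; ×-assoc-*)
    open RawSemiringDefinitions rawSemiring using (_^_)
    open SemiringSums S
    open SemiringSum semiring using (*-distribˡ-sum)
    open Monomials S
    open Evaluation R S
    open Homomorphism {A = R.commutativeSemiring} {B = S} ι-homo
    open CommutativeSemigroupProperties *-commutativeSemigroup using (x∙yz≈y∙xz)
    open import Relation.Binary.Reasoning.Setoid setoid

    ×-homo : ∀ k a → ι (k R.× a) ≈ k × ι a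
    ×-homo zero    a = 0#-homo
    ×-homo (suc k) a = trans (+-homo _ _) (+-congˡ (×-homo k a))

    module _ (D : Carrier → Carrier) (D-cong : ∀ {x y} → x ≈ y → D x ≈ D y)
      (D-+ : ∀ x y → D (x + y) ≈ D x + D y) (D-* : ∀ x y → D (x * y) ≈ D x * y + x * D y)
      (D-ι : ∀ a → D (ι a) ≈ 0#) where

      D-1 : D 1# ≈ 0#
      D-1 = trans (D-cong (sym 1#-homo)) (D-ι R.1#)

      -- At `k = 0` the factor `0 ×` hides the truncated predecessor, so one formula covers all
      -- exponents.
      D-^ : ∀ x k → D (x ^ k) ≈ D x * (k × x ^ ℕ.pred k)
      D-^ x zero          = trans D-1 (sym (zeroʳ _))
      D-^ x (suc zero)    = trans (D-cong (*-identityʳ x)) (sym (trans (*-congˡ (+-identityʳ 1#)) (*-identityʳ _)))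
      D-^ x (suc (suc k)) = begin
        D (x * x ^ suc k)                                   ≈⟨ D-* x (x ^ suc k) ⟩
        D x * x ^ suc k + x * D (x ^ suc k)                 ≈⟨ +-congˡ (*-congˡ (D-^ x (suc k))) ⟩
        D x * x ^ suc k + x * (D x * (suc k × x ^ k))       ≈⟨ +-congˡ (x∙yz≈y∙xz x (D x) _) ⟩
        D x * x ^ suc k + D x * (x * (suc k × x ^ k))       ≈⟨ distribˡ _ _ _ ⟨
        D x * (x ^ suc k + x * (suc k × x ^ k))             ≈⟨ *-congˡ (+-congˡ (×-comm-* (suc k) x (x ^ k))) ⟩
        D x * (x ^ suc k + suc k × x ^ suc k)               ∎

      D-monomial : ∀ (x : Vector Carrier n) α →
        D (monomial x α) ≈ sum λ j → D (x j) * (Vec.lookup α j × monomial x (lower j α))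
      D-monomial x []      = D-1
      D-monomial {suc n} x (a ∷ α) = begin
        D (x₀ ^ a * m)                                ≈⟨ D-* _ _ ⟩
        D (x₀ ^ a) * m + x₀ ^ a * D m                 ≈⟨ +-cong head-term tail-terms ⟩
        D x₀ * (a × (x₀ ^ ℕ.pred a * m)) + sum {n} _  ∎
        where
        x₀ = x zero
        m = monomial (x ∘ suc) α
        head-term : D (x₀ ^ a) * m ≈ D x₀ * (a × (x₀ ^ ℕ.pred a * m))
        head-term = trans (*-congʳ (D-^ x₀ a)) (trans (*-assoc _ _ _) (*-congˡ (×-assoc-* a _ m)))
        tail-terms : x₀ ^ a * D m ≈ sum λ j → D (x (suc j)) * (Vec.lookup α j × (x₀ ^ a * monomial (x ∘ suc) (lower j α)))
        tail-terms = trans (*-congˡ (D-monomial (x ∘ suc) α))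
          (trans (*-distribˡ-sum {n} _ _) (sum-cong-≋ {n} λ j →
            trans (x∙yz≈y∙xz _ _ _) (*-congˡ (×-comm-* (Vec.lookup α j) _ _))))

      D-0 : D 0# ≈ 0#
      D-0 = trans (D-cong (sym 0#-homo)) (D-ι R.0#)

      -- A derivation that kills constants is determined by its values at the `x j`. The case of
      -- interest is `∂ i` on polynomials, with linear forms for `x`.
      chain-rule : ∀ (x : Vector Carrier n) F → D (eval ι x F) ≈ sum λ j → D (x j) * eval ι x (∂ j F)
      chain-rule {n} x []            = trans D-0 (sym (sum-zero {n} λ j → zeroʳ _))
      chain-rule {n} x ((a , α) ∷ F) = begin
        D (ι a * monomial x α + eval ι x F)
          ≈⟨ D-+ _ _ ⟩
        D (ι a * monomial x α) + D (eval ι x F)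
          ≈⟨ +-cong D-term (chain-rule x F) ⟩
        sum {n} _ + sum {n} _
          ≈⟨ ∑-distrib-+ {n} _ _ ⟨
        sum (λ j → D (x j) * (ι (Vec.lookup α j R.× a) * monomial x (lower j α)) + D (x j) * eval ι x (∂ j F))
          ≈⟨ sum-cong-≋ {n} (λ j → sym (distribˡ _ _ _)) ⟩
        sum {n} _ ∎
        where
        D-term : D (ι a * monomial x α) ≈ sum λ j → D (x j) * (ι (Vec.lookup α j R.× a) * monomial x (lower j α))
        D-term = begin
          D (ι a * monomial x α)
            ≈⟨ D-* _ _ ⟩
          D (ι a) * monomial x α + ι a * D (monomial x α)
            ≈⟨ +-congʳ (trans (*-congʳ (D-ι a)) (zeroˡ _)) ⟩
          0# + ι a * D (monomial x α)
            ≈⟨ trans (+-identityˡ _) (*-congˡ (D-monomial x α)) ⟩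
          ι a * sum (λ j → D (x j) * (Vec.lookup α j × monomial x (lower j α)))
            ≈⟨ *-distribˡ-sum {n} _ _ ⟩
          sum (λ j → ι a * (D (x j) * (Vec.lookup α j × monomial x (lower j α))))
            ≈⟨ sum-cong-≋ {n} (λ j → trans (x∙yz≈y∙xz _ _ _) (*-congˡ (begin
                 ι a * (Vec.lookup α j × monomial x (lower j α))     ≈⟨ ×-comm-* (Vec.lookup α j) _ _ ⟩
                 Vec.lookup α j × (ι a * monomial x (lower j α))     ≈⟨ ×-assoc-* (Vec.lookup α j) _ _ ⟨
                 (Vec.lookup α j × ι a) * monomial x (lower j α)     ≈⟨ *-congʳ (×-homo (Vec.lookup α j) a) ⟨
                 ι (Vec.lookup α j R.× a) * monomial x (lower j α)   ∎))) ⟩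
          sum {n} _ ∎

module PartialDerivatives {c ℓ} (R : CommutativeRing c ℓ) where
  open CommutativeRing R hiding (zero)
  open MonoidMult +-monoid using (_×_; ×-congʳ; ×-homo-+; ×-congˡ)
  open CommutativeMonoidMult +-commutativeMonoid using (×-distrib-+)
  open SemiringMult semiring using (×-assoc-*)
  open SemiringSums commutativeSemiring
  open Polynomials R hiding (Poly; IsForm; HasOrder)
  open PolynomialSemiring R
  open LinearExtension R +-commutativeMonoid
  open MonoidMorphisms +-rawMonoid +-rawMonoid using (IsMonoidHomomorphism)
  open Variables R
  open ChainRule R
  open import Relation.Binary.Reasoning.Setoid setoid

  ×-zero : ∀ k → k × 0# ≈ 0#
  ×-zero zero    = refl
  ×-zero (suc k) = trans (+-identityˡ _) (×-zero k)

  -- The adjoint of ∂ i.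
  ∂* : Fin n → (Vec ℕ n → Carrier → Carrier) → Vec ℕ n → Carrier → Carrier
  ∂* i f α a = f (lower i α) (Vec.lookup α i × a)

  linear-∂ : ∀ (f : Vec ℕ n → Carrier → Carrier) i F → linear f (∂ i F) ≈ linear (∂* i f) F
  linear-∂ f i F = linear-map f _ F

  module _ {f : Vec ℕ n → Carrier → Carrier} (f-additive : IsAdditive f) where
    open module F α = IsMonoidHomomorphism (f-additive α) using (⟦⟧-cong; homo; ε-homo)

    ∂*-additive : ∀ i → IsAdditive (∂* i f)
    ∂*-additive i α = mkMonoidHomomorphism
      (λ a≈b → ⟦⟧-cong _ (×-congʳ (Vec.lookup α i) a≈b))
      (λ a b → trans (⟦⟧-cong _ (×-distrib-+ a b (Vec.lookup α i))) (homo _ _ _))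
      (trans (⟦⟧-cong _ (×-zero (Vec.lookup α i))) (ε-homo _))

    private
      ∂*-left : ∀ i α a β b →
        f (lower i α ⊕ β) ((Vec.lookup α i × a) * b) ≈ f (lower i (α ⊕ β)) (Vec.lookup α i × (a * b))
      ∂*-left i α a β b with Vec.lookup α i in eq
      -- The exponents on the two sides can differ here, but both coefficients are 0.
      ... | zero  = trans (⟦⟧-cong _ (zeroˡ b)) (trans (ε-homo _) (sym (ε-homo _)))
      ... | suc k = trans (⟦⟧-cong _ (×-assoc-* (suc k) a b))
        (reflexive (≡.cong (λ γ → f γ (suc k × (a * b))) (lower-⊕ i α β λ α≡0 → ℕ.0≢1+n (≡.trans (≡.sym α≡0) eq))))

      ∂*-right : ∀ i α a β b →
        f (α ⊕ lower i β) (a * (Vec.lookup β i × b)) ≈ f (lower i (α ⊕ β)) (Vec.lookup β i × (a * b))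
      ∂*-right i α a β b = begin
        f (α ⊕ lower i β) (a * (Vec.lookup β i × b))   ≈⟨ ⟦⟧-cong _ (*-comm _ _) ⟩
        f (α ⊕ lower i β) ((Vec.lookup β i × b) * a)   ≡⟨ ≡.cong (λ γ → f γ _) (⊕-comm α _) ⟩
        f (lower i β ⊕ α) ((Vec.lookup β i × b) * a)   ≈⟨ ∂*-left i β b α a ⟩
        f (lower i (β ⊕ α)) (Vec.lookup β i × (b * a)) ≈⟨ ⟦⟧-cong _ (×-congʳ (Vec.lookup β i) (*-comm b a)) ⟩
        f (lower i (β ⊕ α)) (Vec.lookup β i × (a * b)) ≡⟨ ≡.cong (λ γ → f (lower i γ) _) (⊕-comm β α) ⟩
        f (lower i (α ⊕ β)) (Vec.lookup β i × (a * b)) ∎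

    -- The Leibniz rule for two single terms: exponents add in a product, and multiples add with
    -- their multipliers.
    ∂*-⊕ : ∀ i α a β b → ∂* i f (α ⊕ β) (a * b) ≈
      f (lower i α ⊕ β) ((Vec.lookup α i × a) * b) + f (α ⊕ lower i β) (a * (Vec.lookup β i × b))
    ∂*-⊕ i α a β b = begin
      f γ (Vec.lookup (α ⊕ β) i × (a * b))
        ≈⟨ ⟦⟧-cong γ (trans (×-congˡ (Vec.lookup-zipWith ℕ._+_ i α β)) (×-homo-+ (a * b) (Vec.lookup α i) (Vec.lookup β i))) ⟩
      f γ (Vec.lookup α i × (a * b) + Vec.lookup β i × (a * b))
        ≈⟨ homo γ _ _ ⟩
      f γ (Vec.lookup α i × (a * b)) + f γ (Vec.lookup β i × (a * b))
        ≈⟨ +-cong (∂*-left i α a β b) (∂*-right i α a β b) ⟨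
      f (lower i α ⊕ β) ((Vec.lookup α i × a) * b) + f (α ⊕ lower i β) (a * (Vec.lookup β i × b)) ∎
      where γ = lower i (α ⊕ β)

  ∂-cong : ∀ (i : Fin n) {F G} → F ≃ G → ∂ i F ≃ ∂ i G
  ∂-cong i {F} {G} F≃G = ≃-from-linear λ {f} f+ → begin
    linear f (∂ i F)     ≈⟨ linear-∂ f i F ⟩
    linear (∂* i f) F    ≈⟨ ≃-to-linear F≃G (∂*-additive f+ i) ⟩
    linear (∂* i f) G    ≈⟨ linear-∂ f i G ⟨
    linear f (∂ i G)     ∎

  ∂-* : ∀ (i : Fin n) F G → ∂ i (F *ₚ G) ≃ ∂ i F *ₚ G ++ F *ₚ ∂ i G
  ∂-* i F G = ≃-from-linear λ {f} f+ → begin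
    linear f (∂ i (F *ₚ G))
      ≈⟨ linear-∂ f i (F *ₚ G) ⟩
    linear (∂* i f) (F *ₚ G)
      ≈⟨ linear-*ₚ (∂* i f) F G ⟩
    linear (λ α a → linear (λ β b → ∂* i f (α ⊕ β) (a * b)) G) F
      ≈⟨ linear-cong (λ α a → trans (linear-cong (λ β b → ∂*-⊕ f+ i α a β b) G) (linear-∙ _ _ G)) F ⟩
    linear (λ α a → linear (λ β b → f (lower i α ⊕ β) ((Vec.lookup α i × a) * b)) G +
                    linear (λ β b → f (α ⊕ lower i β) (a * (Vec.lookup β i × b))) G) F
      ≈⟨ linear-∙ _ _ F ⟩
    linear (λ α a → linear (λ β b → f (lower i α ⊕ β) ((Vec.lookup α i × a) * b)) G) F +
    linear (λ α a → linear (λ β b → f (α ⊕ lower i β) (a * (Vec.lookup β i × b))) G) F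
      ≈⟨ +-cong (trans (linear-*ₚ f (∂ i F) G) (linear-∂ _ i F))
                (trans (linear-*ₚ f F (∂ i G)) (linear-cong (λ α a → linear-∂ _ i G) F)) ⟨
    linear f (∂ i F *ₚ G) + linear f (F *ₚ ∂ i G)
      ≈⟨ linear-++ f (∂ i F *ₚ G) (F *ₚ ∂ i G) ⟨
    linear f (∂ i F *ₚ G ++ F *ₚ ∂ i G) ∎

  ∂-constant : ∀ (i : Fin n) a → ∂ i (constant a) ≃ []
  ∂-constant {n} i a = ≃-from-linear λ {f} f+ → trans (+-identityʳ _) (trans
    (IsMonoidHomomorphism.⟦⟧-cong (f+ _) (×-congˡ (Vec.lookup-replicate i 0)))
    (IsMonoidHomomorphism.ε-homo (f+ _)))

  ∂-linearForm : ∀ (i : Fin n) a → ∂ i (linearForm a) ≃ constant (a i)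
  ∂-linearForm {n} i a = ≃-from-linear λ {f} f+ → let open module H α = IsMonoidHomomorphism (f+ α) in begin
    linear f (∂ i (linearForm a))
      ≈⟨ linear-∂ f i (linearForm a) ⟩
    linear (∂* i f) (linearForm a)
      ≡⟨ linear-tabulate (∂* i f) (λ j → a j , unit j) ⟩
    sum (λ j → f (lower i (unit j)) (Vec.lookup (unit j) i × a j))
      ≈⟨ sum-single i _ (λ j j≢i → trans
           (⟦⟧-cong _ (×-congˡ (≡.trans (Vec.lookup∘update′ (j≢i ∘ ≡.sym) (Vec.replicate n 0) 1) (Vec.lookup-replicate i 0)))) (ε-homo _)) ⟩
    f (lower i (unit i)) (Vec.lookup (unit i) i × a i)
      ≈⟨ ⟦⟧-cong _ (trans (×-congˡ (Vec.lookup∘update i (Vec.replicate n 0) 1)) (+-identityʳ _)) ⟩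
    f (lower i (unit i)) (a i)
      ≡⟨ ≡.cong (λ α → f α (a i)) (lower-unit i) ⟩
    f (Vec.replicate n 0) (a i)
      ≈⟨ +-identityʳ _ ⟨
    linear f (constant (a i)) ∎

  coeff-∂ : ∀ (i : Fin n) F γ → coeff (∂ i F) γ ≈ suc (Vec.lookup γ i) × coeff F (raise i γ)
  coeff-∂ i []            γ = sym (×-zero (suc (Vec.lookup γ i)))
  coeff-∂ i ((a , α) ∷ F) γ = trans (+-cong (coeff-term (raise i γ ≟ᵛ α)) (coeff-∂ i F γ))
    (sym (×-distrib-+ _ _ (suc (Vec.lookup γ i))))
    where
    coeff-term : (γ≟α : Dec (raise i γ ≡ α)) → (if does (γ ≟ᵛ lower i α) then Vec.lookup α i × a else 0#) ≈
      suc (Vec.lookup γ i) × (if does γ≟α then a else 0#)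
    coeff-term (yes ≡.refl) = trans
      (reflexive (≡.cong (λ b → if b then Vec.lookup (raise i γ) i × a else 0#)
        (dec-true (γ ≟ᵛ lower i (raise i γ)) (≡.sym (lower-raise i γ)))))
      (×-congˡ (lookup-raise i γ))
    coeff-term (no γ≢α) with γ ≟ᵛ lower i α
    ... | no  _      = sym (×-zero (suc (Vec.lookup γ i)))
    -- A match after lowering without one before is an effect of truncation, so the exponent in `α`
    -- is 0 and the differentiated term vanishes.
    ... | yes ≡.refl = trans (×-congˡ α≡0) (sym (×-zero (suc (Vec.lookup γ i))))
      where
      α≡0 : Vec.lookup α i ≡ 0
      α≡0 = decidable-stable (Vec.lookup α i ℕ.≟ 0) λ α≢0 → γ≢α (raise-lower i α α≢0)

  coeff-sum : ∀ {m} (F : Vector (Poly R n) m) α →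
    coeff (RawSemiringDefinitions.sum (CommutativeSemiring.rawSemiring (polynomials n)) F) α ≈ sum λ j → coeff (F j) α
  coeff-sum {m = zero}  F α = refl
  coeff-sum {m = suc m} F α = trans (coeff-++ (F zero) _) (+-congˡ (coeff-sum (F ∘ suc) α))
    where
    coeff-++ : ∀ F G → coeff (F ++ G) α ≈ coeff F α + coeff G α
    coeff-++ []      G = sym (+-identityˡ _)
    coeff-++ (_ ∷ F) G = trans (+-congˡ (coeff-++ F G)) (sym (+-assoc _ _ _))

  coeff-constant-* : ∀ a (F : Poly R n) α → coeff (constant a *ₚ F) α ≈ a * coeff F α
  coeff-constant-* a []            α = sym (zeroʳ a)
  coeff-constant-* a ((b , β) ∷ F) α rewrite ⊕-identityˡ β = trans (+-cong coeff-term (coeff-constant-* a F α)) (sym (distribˡ a _ _))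
    where
    coeff-term : (if does (α ≟ᵛ β) then a * b else 0#) ≈ a * (if does (α ≟ᵛ β) then b else 0#)
    coeff-term with does (α ≟ᵛ β)
    ... | true  = refl
    ... | false = sym (zeroʳ a)

  directional : Vector Carrier n → Poly R n → Poly R n
  directional {n} w F = RawSemiringDefinitions.sum (CommutativeSemiring.rawSemiring (polynomials n))
    λ j → constant (w j) *ₚ ∂ j F

  coeff-directional : ∀ (w : Vector Carrier n) F γ → coeff (directional w F) γ ≈ sum λ j → w j * coeff (∂ j F) γ
  coeff-directional {n} w F γ = trans (coeff-sum {n} {n} _ γ) (sum-cong-≋ {n} λ j → coeff-constant-* (w j) (∂ j F) γ)

  -- The derivative of the `j`-th linear form is the constant `A j i`; being a constant, it can be
  -- moved back inside the substitution.
  ∂-changeVariables : ∀ (i : Fin n) A F → ∂ i (changeVariables A F) ≃ changeVariables A (directional (λ j → A j i) F)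
  ∂-changeVariables {n} i A F = R[x].trans
    (R[x].reflexive (≡.cong (∂ i) (substitute-eval F L)))
    (R[x].trans
      (chain-rule R[x] constant-homo (∂ i) (∂-cong i) (λ F G → R[x].reflexive (List.map-++ _ F G)) (∂-* i) (∂-constant i) L F)
      (R[x].trans
        (∑.sum-cong-≋ {n} λ j → R[x].*-cong {x = ∂ i (L j)} {u = eval constant L (∂ j F)}
          (R[x].trans (∂-linearForm i (A j)) (R[x].sym (eval-constant constant-homo L (A j i)))) R[x].refl)
        (R[x].trans
          (R[x].trans
            (∑.sum-cong-≋ {n} λ j → R[x].sym (eval-*ₚ constant-homo L (constant (A j i)) (∂ j F)))
            (R[x].sym (Homomorphism.sum-homo {A = R[x]} {B = R[x]} (eval-homo constant-homo L) {n} λ j → constant (A j i) *ₚ ∂ j F)))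
          (R[x].reflexive (≡.sym (substitute-eval (directional (λ j → A j i) F) L))))))
    where
    R[x] = polynomials n
    module R[x] = CommutativeSemiring (polynomials n)
    module ∑ = SemiringSums R[x]
    open Evaluation R R[x]
    L : Vector (Poly R n) n
    L j = linearForm (A j)

  module _ (A : Matrix n) (i : Fin n) (F : Poly R n) where
    private module R[x] = CommutativeSemiring (polynomials n)

    -- `∂ i` of the transform is 0 in any characteristic. By the chain rule it is the transform of a
    -- directional derivative, from which the invertible `A` is cancelled.
    directional-zero : Invertible A → (∀ α → Vec.lookup α i ≢ 0 → coeff (changeVariables A F) α ≈ 0#) →
      ∀ γ → sum (λ j → A j i * coeff (∂ j F) γ) ≈ 0#
    directional-zero (B , AB≈1 , _) F∘A-free γ = trans (sym (coeff-directional _ F γ))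
      (coefficients (R[x].trans
        (R[x].sym (changeVariables-inverse AB≈1 (directional (λ j → A j i) F)))
        (Evaluation.eval-resp-≃ R (polynomials n) constant-homo (λ j → linearForm (B j))
          (R[x].trans (R[x].sym (∂-changeVariables i A F)) ∂≃0))) γ)
      where
      ∂≃0 : ∂ i (changeVariables A F) ≃ []
      ∂≃0 = coefficientwise λ γ → trans (coeff-∂ i (changeVariables A F) γ)
        (trans (×-congʳ (suc (Vec.lookup γ i)) (F∘A-free (raise i γ)
          λ raise≡0 → ℕ.1+n≢0 (≡.trans (≡.sym (lookup-raise i γ)) raise≡0)))
          (×-zero (suc (Vec.lookup γ i))))

    -- A vanishing derivative says only that exponent times coefficient is 0; torsion-freeness
    -- divides by the exponent. Singular `A` are covered, as required for a matrix that becomes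
    -- invertible only over `K`.
    directional-zero⁻¹ : (∀ k {a} → suc k × a ≈ 0# → a ≈ 0#) → (∀ γ → sum (λ j → A j i * coeff (∂ j F) γ) ≈ 0#) →
      ∀ α → Vec.lookup α i ≢ 0 → coeff (changeVariables A F) α ≈ 0#
    directional-zero⁻¹ torsion-free F-zero α α≢0 = torsion-free (Vec.lookup (lower i α) i) (begin
      suc (Vec.lookup (lower i α) i) × coeff (changeVariables A F) α
        ≡⟨ ≡.cong (λ β → suc (Vec.lookup (lower i α) i) × coeff (changeVariables A F) β) (raise-lower i α α≢0) ⟨
      suc (Vec.lookup (lower i α) i) × coeff (changeVariables A F) (raise i (lower i α))
        ≈⟨ coeff-∂ i (changeVariables A F) (lower i α) ⟨
      coeff (∂ i (changeVariables A F)) (lower i α)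
        ≈⟨ coefficients (∂-changeVariables i A F) (lower i α) ⟩
      coeff (changeVariables A ∇F) (lower i α)
        ≈⟨ coefficients eval≃0 (lower i α) ⟩
      0# ∎)
      where
      ∇F = directional (λ j → A j i) F
      eval≃0 : changeVariables A ∇F ≃ []
      eval≃0 = R[x].trans (R[x].reflexive (substitute-eval ∇F _))
        (Evaluation.eval-resp-≃ R (polynomials n) constant-homo (λ j → linearForm (A j)) {∇F} {[]}
          (coefficientwise λ γ → trans (coeff-directional _ F γ) (F-zero γ)))

-- Integer linear systems

ℤ-semiring : CommutativeSemiring 0ℓ 0ℓ
ℤ-semiring = CommutativeRing.commutativeSemiring ℤ-ring

-- The map from ℤ is carried as data so that `overℚ` and `reduce p` are instances of `baseChange` by
-- definition.
record ℤ-Algebra : Set₁ where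
  field
    ring : CommutativeRing 0ℓ 0ℓ
    cast : ℤ → CommutativeRing.Carrier ring
    cast-homo : IsHomomorphism ℤ-semiring (CommutativeRing.commutativeSemiring ring) cast
  open CommutativeRing ring public hiding (ring; zero)
  open Homomorphism {A = ℤ-semiring} {B = commutativeSemiring} cast-homo public
  open BaseChange {R = ℤ-ring} {K = ring} cast cast-homo public
  open SemiringSums commutativeSemiring public using (sum; sum-zero; sum-cong-≋; ∑-distrib-+; δ; δ-diagonal)
  open SemiringSum semiring public using (*-distribˡ-sum)

  IsUnit : ℤ → Set
  IsUnit z = ∃ λ t → cast z * t ≈ 1#

  infix 8 _∙_
  _∙_ : Vector ℤ n → Vector Carrier n → Carrier
  r ∙ v = sum λ j → cast (r j) * v j

  combination-∙ : ∀ a b (x y : Vector ℤ n) v →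
    (λ j → a ℤ.* x j ℤ.+ b ℤ.* y j) ∙ v ≈ cast a * x ∙ v + cast b * y ∙ v
  combination-∙ {n} a b x y v = begin
    sum (λ j → cast (a ℤ.* x j ℤ.+ b ℤ.* y j) * v j)
      ≈⟨ sum-cong-≋ {n} (λ j → trans (*-congʳ (trans (+-homo _ _) (+-cong (*-homo _ _) (*-homo _ _)))) (distribʳ _ _ _)) ⟩
    sum (λ j → cast a * cast (x j) * v j + cast b * cast (y j) * v j)
      ≈⟨ sum-cong-≋ {n} (λ j → +-cong (*-assoc _ _ _) (*-assoc _ _ _)) ⟩
    sum (λ j → cast a * (cast (x j) * v j) + cast b * (cast (y j) * v j))
      ≈⟨ ∑-distrib-+ {n} _ _ ⟩
    sum (λ j → cast a * (cast (x j) * v j)) + sum (λ j → cast b * (cast (y j) * v j))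
      ≈⟨ +-cong (*-distribˡ-sum {n} _ _) (*-distribˡ-sum {n} _ _) ⟨
    cast a * x ∙ v + cast b * y ∙ v ∎
    where open import Relation.Binary.Reasoning.Setoid setoid

ℤ-algebra : ℤ-Algebra
ℤ-algebra = record
  { ring = ℤ-ring
  ; cast = id
  ; cast-homo = mkSemiringHomomorphism id (λ _ _ → ≡.refl) ≡.refl (λ _ _ → ≡.refl) ≡.refl }

-- If D is a unit in K, the rows thus have trivial kernel over K.
KernelKilledBy : ∀ {m} → (Fin m → Vector ℤ n) → ℤ → Set₁
KernelKilledBy {n} rows D = ∀ (K : ℤ-Algebra) → let open ℤ-Algebra K in
  ∀ (v : Vector Carrier n) → (∀ k → rows k ∙ v ≈ 0#) → ∀ j → cast D * v j ≈ 0#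

KernelVector : ∀ {m} → (Fin m → Vector ℤ n) → Set
KernelVector {n} rows = ∃ λ (w : Vector ℤ n) → (∃ λ i → w i ≢ + 0) Product.× (∀ k → ℤ-Algebra._∙_ ℤ-algebra (rows k) w ≡ + 0)

module _ {m} (rows : Fin m → Vector ℤ (suc n)) where

  -- A zero column leaves its unknown free, so the first basis vector is a solution.
  first-column-zero : (∀ k → rows k zero ≡ + 0) → KernelVector rows
  first-column-zero column≡0 = w , (zero , λ ()) , λ k → ≡.cong₂ ℤ._+_
    (≡.trans (ℤ.*-identityʳ (rows k zero)) (column≡0 k))
    (sum-zero {n} λ j → ℤ.*-zeroʳ (rows k (suc j)))
    where
    open ℤ-Algebra ℤ-algebra
    w : Vector ℤ (suc n)
    w zero    = + 1
    w (suc _) = + 0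

  module Pivot (p : Fin m) (pivot≢0 : rows p zero ≢ + 0) where
    private
      a : ℤ
      a = rows p zero

      y : Vector ℤ n
      y j = rows p (suc j)

    -- Cross-multiplication with the pivot row replaces division. The pivot row itself stays in the
    -- system as a row of zeros.
    reduced : Fin m → Vector ℤ n
    reduced k j = a ℤ.* rows k (suc j) ℤ.+ (ℤ.- rows k zero) ℤ.* y j

    lift-kernel : KernelVector reduced → KernelVector rows
    lift-kernel (v , (i , vᵢ≢0) , reduced∙v≡0) = w , (suc i , avᵢ≢0) , λ k →
      ≡.trans (≡.cong₂ ℤ._+_ {rows k zero ℤ.* (ℤ.- (y ∙ v))} ≡.refl (scale k))
        (≡.trans (rearrange (rows k zero) (y ∙ v) a ((λ j → rows k (suc j)) ∙ v))
          (≡.trans (≡.sym (combination-∙ a (ℤ.- rows k zero) (λ j → rows k (suc j)) y v)) (reduced∙v≡0 k)))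
      where
      open ℤ-Algebra ℤ-algebra using (_∙_; combination-∙; *-distribˡ-sum; sum-cong-≋)
      -- The solution of the pivot equation, scaled by `a` to avoid dividing by the pivot.
      w : Vector ℤ (suc n)
      w zero    = ℤ.- (y ∙ v)
      w (suc j) = a ℤ.* v j
      avᵢ≢0 : a ℤ.* v i ≢ + 0
      avᵢ≢0 avᵢ≡0 with ℤ.i*j≡0⇒i≡0∨j≡0 a avᵢ≡0
      ... | inj₁ a≡0  = pivot≢0 a≡0
      ... | inj₂ vᵢ≡0 = vᵢ≢0 vᵢ≡0
      scale : ∀ k → (λ j → rows k (suc j)) ∙ (λ j → a ℤ.* v j) ≡ a ℤ.* ((λ j → rows k (suc j)) ∙ v)
      scale k = ≡.trans
        (sum-cong-≋ {n} λ j → commute (rows k (suc j)) a (v j))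
        (≡.sym (*-distribˡ-sum {n} a λ j → rows k (suc j) ℤ.* v j))
        where
        commute : ∀ r a v → r ℤ.* (a ℤ.* v) ≡ a ℤ.* (r ℤ.* v)
        commute = ℤ-Solver.solve-∀
      rearrange : ∀ c Y a X → c ℤ.* (ℤ.- Y) ℤ.+ a ℤ.* X ≡ a ℤ.* X ℤ.+ (ℤ.- c) ℤ.* Y
      rearrange = ℤ-Solver.solve-∀

    -- The pivot cannot be divided out in a general `K`, so it joins the annihilator; `D` ends up as
    -- the product of the pivots. The pivot row yields the first coordinate once `D` has killed the
    -- others.
    lift-killed : ∀ {D} → KernelKilledBy reduced D → KernelKilledBy rows (a ℤ.* D)
    lift-killed {D} reduced-killed K v rows∙v≈0 = λ where
        zero    → begin
          cast (a ℤ.* D) * v zero                                  ≈⟨ *-congʳ (trans (*-homo a D) (*-comm _ _)) ⟩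
          cast D * cast a * v zero                                 ≈⟨ *-assoc _ _ _ ⟩
          cast D * (cast a * v zero)                               ≈⟨ +-identityʳ _ ⟨
          cast D * (cast a * v zero) + 0#                          ≈⟨ +-congˡ D*y∙v′≈0 ⟨
          cast D * (cast a * v zero) + cast D * y ∙ v′             ≈⟨ distribˡ _ _ _ ⟨
          cast D * (cast a * v zero + y ∙ v′)                      ≈⟨ *-congˡ (rows∙v≈0 p) ⟩
          cast D * 0#                                              ≈⟨ zeroʳ _ ⟩
          0#                                                       ∎
        (suc j) → begin
          cast (a ℤ.* D) * v (suc j)                               ≈⟨ *-congʳ (*-homo a D) ⟩
          cast a * cast D * v (suc j)                              ≈⟨ *-assoc _ _ _ ⟩
          cast a * (cast D * v (suc j))                            ≈⟨ *-congˡ (D*v′≈0 j) ⟩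
          cast a * 0#                                              ≈⟨ zeroʳ _ ⟩
          0#                                                       ∎
      where
      open ℤ-Algebra K
      open CommutativeSemigroupProperties *-commutativeSemigroup using (x∙yz≈y∙xz)
      open CommutativeSemigroupProperties +-commutativeSemigroup using () renaming (interchange to +-interchange)
      open import Relation.Binary.Reasoning.Setoid setoid
      v′ : Vector Carrier n
      v′ j = v (suc j)
      reduced∙v′≈0 : ∀ k → reduced k ∙ v′ ≈ 0#
      reduced∙v′≈0 k = begin
        reduced k ∙ v′
          ≈⟨ combination-∙ a (ℤ.- c) x y v′ ⟩
        cast a * x ∙ v′ + cast (ℤ.- c) * y ∙ v′
          ≈⟨ +-identityˡ _ ⟨
        -- The first coordinate is put back with total contribution 0, which completes both groups
        -- to original rows.
        0# + (cast a * x ∙ v′ + cast (ℤ.- c) * y ∙ v′)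
          ≈⟨ +-congʳ cancel ⟨
        (cast a * (cast c * v zero) + cast (ℤ.- c) * (cast a * v zero)) + (cast a * x ∙ v′ + cast (ℤ.- c) * y ∙ v′)
          ≈⟨ +-interchange _ _ _ _ ⟩
        (cast a * (cast c * v zero) + cast a * x ∙ v′) + (cast (ℤ.- c) * (cast a * v zero) + cast (ℤ.- c) * y ∙ v′)
          ≈⟨ +-cong (distribˡ _ _ _) (distribˡ _ _ _) ⟨
        cast a * (cast c * v zero + x ∙ v′) + cast (ℤ.- c) * (cast a * v zero + y ∙ v′)
          ≈⟨ +-cong (*-congˡ (rows∙v≈0 k)) (*-congˡ (rows∙v≈0 p)) ⟩
        cast a * 0# + cast (ℤ.- c) * 0#
          ≈⟨ trans (+-cong (zeroʳ _) (zeroʳ _)) (+-identityʳ _) ⟩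
        0# ∎
        where
        c = rows k zero
        x : Vector ℤ n
        x j = rows k (suc j)
        cast-+-inverse : cast c + cast (ℤ.- c) ≈ 0#
        cast-+-inverse = trans (sym (+-homo c (ℤ.- c))) (trans (⟦⟧-cong (ℤ.+-inverseʳ c)) 0#-homo)
        cancel : cast a * (cast c * v zero) + cast (ℤ.- c) * (cast a * v zero) ≈ 0#
        cancel = begin
          cast a * (cast c * v zero) + cast (ℤ.- c) * (cast a * v zero)   ≈⟨ +-congʳ (x∙yz≈y∙xz _ _ _) ⟩
          cast c * (cast a * v zero) + cast (ℤ.- c) * (cast a * v zero)   ≈⟨ distribʳ _ _ _ ⟨
          (cast c + cast (ℤ.- c)) * (cast a * v zero)                     ≈⟨ *-congʳ cast-+-inverse ⟩
          0# * (cast a * v zero)                                          ≈⟨ zeroˡ _ ⟩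
          0#                                                              ∎
      D*v′≈0 : ∀ j → cast D * v′ j ≈ 0#
      D*v′≈0 = reduced-killed K v′ reduced∙v′≈0
      D*y∙v′≈0 : cast D * y ∙ v′ ≈ 0#
      D*y∙v′≈0 = trans (*-distribˡ-sum {n} _ _) (sum-zero {n} λ j →
        trans (x∙yz≈y∙xz _ _ _) (trans (*-congˡ (D*v′≈0 j)) (zeroʳ _)))

-- Each step removes one unknown. A kernel vector of the smaller system lifts; otherwise the nonzero
-- pivots have a nonzero product, ℤ being a domain. Decidable equality in ℤ keeps the choice
-- constructive.
kernel-dichotomy : ∀ {n m} (rows : Fin m → Vector ℤ n) →
  (∃ λ D → (D ≢ + 0) Product.× KernelKilledBy rows D) ⊎ KernelVector rows
kernel-dichotomy {zero}  rows = inj₁ (+ 1 , (λ ()) , λ _ _ _ ())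
kernel-dichotomy {suc n} rows with Fin.any? (λ k → ¬? (rows k zero ℤ.≟ + 0))
... | no  column≡0     = inj₂ (first-column-zero rows λ k →
  decidable-stable (rows k zero ℤ.≟ + 0) λ r≢0 → column≡0 (k , r≢0))
... | yes (p , pivot≢0) with kernel-dichotomy (Pivot.reduced rows p pivot≢0)
...   | inj₂ w               = inj₂ (Pivot.lift-kernel rows p pivot≢0 w)
...   | inj₁ (D , D≢0 , killed) = inj₁ (rows p zero ℤ.* D ,
  (λ aD≡0 → [ pivot≢0 , D≢0 ]′ (ℤ.i*j≡0⇒i≡0∨j≡0 (rows p zero) aD≡0)) , Pivot.lift-killed rows p pivot≢0 killed)

-- Orders

module Matrices {c ℓ} (R : CommutativeRing c ℓ) where
  open CommutativeRing R hiding (zero)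
  open SemiringSums commutativeSemiring
  open SemiringSum semiring using (*-distribˡ-sum)
  open Polynomials R using (Matrix; _·_; _≈ₘ_; identity; Invertible)
  open import Relation.Binary.Reasoning.Setoid setoid

  identity-invertible : Invertible (identity {n})
  identity-invertible = identity , identity-idem , identity-idem
    where
    identity-idem : identity {n} · identity ≈ₘ identity
    identity-idem i j = sum-δˡ i (λ k → δ k j)

  Invertible-resp-≈ₘ : ∀ {A A′ : Matrix n} → A ≈ₘ A′ → Invertible A → Invertible A′
  Invertible-resp-≈ₘ {n} A≈A′ (B , AB≈1 , BA≈1) = B
    , (λ i j → trans (sum-cong-≋ {n} λ k → *-congʳ (sym (A≈A′ i k))) (AB≈1 i j))
    , (λ i j → trans (sum-cong-≋ {n} λ k → *-congˡ (sym (A≈A′ k j))) (BA≈1 i j))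

  -- 1 + x eᵢᵀ, where eᵢ is the i-th basis vector.
  elementary : Fin n → Vector Carrier n → Matrix n
  elementary i x j k = δ j k + x j * δ i k

  -- (1 + x eᵢᵀ)(1 + y eᵢᵀ) = 1 + (y + (1 + yᵢ) x) eᵢᵀ, and the hypothesis kills the rank-one part.
  elementary-· : ∀ (i : Fin n) x y → (∀ j → y j + x j * (1# + y i) ≈ 0#) → elementary i x · elementary i y ≈ₘ identity
  elementary-· {n} i x y cancel j k = begin
    sum (λ l → (δ j l + x j * δ i l) * E l)
      ≈⟨ sum-cong-≋ {n} (λ l → trans (distribʳ _ _ _) (+-congˡ (*-assoc _ _ _))) ⟩
    sum (λ l → δ j l * E l + x j * (δ i l * E l))
      ≈⟨ ∑-distrib-+ {n} _ _ ⟩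
    sum (λ l → δ j l * E l) + sum (λ l → x j * (δ i l * E l))
      ≈⟨ +-cong (sum-δˡ j E) (trans (sym (*-distribˡ-sum {n} _ _)) (*-congˡ (sum-δˡ i E))) ⟩
    (δ j k + y j * δ i k) + x j * (δ i k + y i * δ i k)
      ≈⟨ +-congˡ (*-congˡ (trans (+-congʳ (sym (*-identityˡ _))) (sym (distribʳ _ _ _)))) ⟩
    (δ j k + y j * δ i k) + x j * ((1# + y i) * δ i k)
      ≈⟨ +-congˡ (*-assoc _ _ _) ⟨
    (δ j k + y j * δ i k) + x j * (1# + y i) * δ i k
      ≈⟨ +-assoc _ _ _ ⟩
    δ j k + (y j * δ i k + x j * (1# + y i) * δ i k)
      ≈⟨ +-congˡ (distribʳ _ _ _) ⟨
    δ j k + (y j + x j * (1# + y i)) * δ i k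
      ≈⟨ +-congˡ (trans (*-congʳ (cancel j)) (zeroˡ _)) ⟩
    δ j k + 0#
      ≈⟨ +-identityʳ _ ⟩
    δ j k ∎
    where
    E : Vector Carrier n
    E l = elementary i y l k

  -- The Sherman-Morrison formula: `1# + x i` is the determinant, and the inverse has the same shape
  -- with `- t x` for `x`.
  elementary-invertible : ∀ (i : Fin n) x {t} → (1# + x i) * t ≈ 1# → Invertible (elementary i x)
  elementary-invertible i x {t} [1+xᵢ]t≈1 = elementary i y
    , elementary-· i x y (λ j → trans (+-congˡ (*-congˡ 1+yᵢ≈t)) (-‿inverseˡ _))
    , elementary-· i y x (λ j → trans (+-congˡ (-x*t*[1+xᵢ] j)) (-‿inverseʳ _))
    where
    open RingProperties ring using (-‿distribˡ-*)
    y : Vector Carrier _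
    y j = - (x j * t)
    1+yᵢ≈t : 1# + y i ≈ t
    1+yᵢ≈t = begin
      1# + - (x i * t)               ≈⟨ +-congʳ [1+xᵢ]t≈1 ⟨
      (1# + x i) * t + - (x i * t)   ≈⟨ +-congʳ (trans (distribʳ _ _ _) (+-congʳ (*-identityˡ t))) ⟩
      (t + x i * t) + - (x i * t)    ≈⟨ +-assoc _ _ _ ⟩
      t + (x i * t + - (x i * t))    ≈⟨ +-congˡ (-‿inverseʳ _) ⟩
      t + 0#                         ≈⟨ +-identityʳ t ⟩
      t                              ∎
    -x*t*[1+xᵢ] : ∀ j → y j * (1# + x i) ≈ - x j
    -x*t*[1+xᵢ] j = begin
      - (x j * t) * (1# + x i)       ≈⟨ -‿distribˡ-* _ _ ⟨
      - (x j * t * (1# + x i))       ≈⟨ -‿cong (trans (*-assoc _ _ _) (*-congˡ (trans (*-comm _ _) [1+xᵢ]t≈1))) ⟩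
      - (x j * 1#)                   ≈⟨ -‿cong (*-identityʳ _) ⟩
      - x j                          ∎

module Orders {c ℓ} (R : CommutativeRing c ℓ) where
  open CommutativeRing R hiding (zero)
  open Polynomials R using (coeff; changeVariables; identity; Invertible; ReducesTo)

  Eliminates : Poly R n → Polynomials.Matrix R n → Fin n → Set ℓ
  Eliminates F A i = ∀ α → Vec.lookup α i ≢ 0 → coeff (changeVariables A F) α ≈ 0#

  reducesTo-all : ∀ (F : Poly R n) → ReducesTo F n
  reducesTo-all {n} F = changeVariables identity F
    , (identity , Matrices.identity-invertible R , λ _ → refl)
    , ⊤ , Subset.∣⊤∣≡n n , λ _ _ → Subset.∈⊤

  eliminates⇒reducesTo : ∀ (F : Poly R (suc n)) A {i} → Invertible A → Eliminates F A i → ReducesTo F n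
  eliminates⇒reducesTo {n} F A {i} A-invertible eliminates = changeVariables A F
    , (A , A-invertible , λ _ → refl)
    , ∁ ⁅ i ⁆
    , ≡.trans (Subset.∣∁p∣≡n∸∣p∣ ⁅ i ⁆) (≡.cong (suc n ℕ.∸_) (Subset.∣⁅x⁆∣≡1 i))
    , λ j (α , α∈F , αⱼ≢0) → Subset.x∉p⇒x∈∁p λ j∈⁅i⁆ →
        α∈F (eliminates α (≡.subst (λ k → Vec.lookup α k ≢ 0) (Subset.x∈⁅y⁆⇒x≡y i j∈⁅i⁆) αⱼ≢0))

  missing : ∀ (S : Subset n) → ∣ S ∣ ℕ.< n → ∃ λ i → i Subset.∉ S
  missing {n} S ∣S∣<n with Fin.any? (λ i → ¬? (i Subset.∈? S))
  ... | yes i∉S = i∉S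
  ... | no  all∈S = contradiction
    (≡.subst (ℕ._≤ ∣ S ∣) (Subset.∣⊤∣≡n n) (Subset.p⊆q⇒∣p∣≤∣q∣ {p = ⊤} λ {i} _ →
      decidable-stable (i Subset.∈? S) λ i∉S → all∈S (i , i∉S)))
    (ℕ.<⇒≱ ∣S∣<n)

  reducesTo⇒eliminates : (∀ x y → Dec (x ≈ y)) → ∀ (F : Poly R n) {k} → ReducesTo F k → k ℕ.< n →
    ∃ λ A → Invertible A Product.× ∃ (Eliminates F A)
  reducesTo⇒eliminates _≈?_ F (G , (A , A-invertible , G≈F∘A) , S , ≡.refl , G⊆S) ∣S∣<n =
    let i , i∉S = missing S ∣S∣<n in
    -- `Involves` contains a negated equality, so a missing variable gives only the double negation
    -- of vanishing; decidability removes it.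
    A , A-invertible , i , λ α αᵢ≢0 → decidable-stable (_ ≈? 0#) λ α∈F∘A →
      i∉S (G⊆S i (α , (λ α∉G → α∈F∘A (trans (sym (G≈F∘A α)) α∉G)) , αᵢ≢0))

ℤ-torsion-free : ∀ k {a} → MonoidMult._×_ (CommutativeRing.+-monoid ℤ-ring) (suc k) a ≡ + 0 → a ≡ + 0
ℤ-torsion-free k {a} ka≡0 with ℤ.i*j≡0⇒i≡0∨j≡0 (+ suc k) (≡.trans (≡.sym (×-ℤ (suc k))) ka≡0)
  where
  open MonoidMult (CommutativeRing.+-monoid ℤ-ring) using (_×_)
  ×-ℤ : ∀ k → k × a ≡ + k ℤ.* a
  ×-ℤ zero    = ≡.refl
  ×-ℤ (suc k) = ≡.trans (≡.cong (λ b → a ℤ.+ b) (×-ℤ k)) (≡.sym (ℤ.suc-* (+ k) a))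
... | inj₂ a≡0 = a≡0

module Gradient (F : Poly ℤ-ring (suc n)) where
  open ChainRule ℤ-ring using (∂)
  open Polynomials ℤ-ring using (coeff)

  gradient : Vec ℕ (suc n) → Vector ℤ (suc n)
  gradient γ j = coeff (∂ j F) γ

  private
    -- Finitely many exponents carry all coefficients of the partial derivatives, so their relations
    -- are the kernel of a finite matrix. Repetitions merely repeat rows.
    Γ : List (Vec ℕ (suc n))
    Γ = List.concat (List.tabulate λ j → exponents (∂ j F))

    rows : Fin (List.length Γ) → Vector ℤ (suc n)
    rows k = gradient (List.lookup Γ k)

    ∈Γ⁺ : ∀ j {γ} → γ ∈ exponents (∂ j F) → γ ∈ Γ
    ∈Γ⁺ j γ∈∂F = ∈.∈-concat⁺′ γ∈∂F (∈.∈-tabulate⁺ {f = λ j → exponents (∂ j F)} j)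

  module _ (K : ℤ-Algebra) where
    open ℤ-Algebra K

    -- Differentiation multiplies coefficients by natural numbers, which homomorphisms respect;
    -- hence one integer matrix describes the relations over every `K`.
    cast-gradient : ∀ γ j → Polynomials.coeff ring (ChainRule.∂ ring j (baseChange F)) γ ≈ cast (gradient γ j)
    cast-gradient γ j = begin
      Polynomials.coeff ring (ChainRule.∂ ring j (baseChange F)) γ
        ≈⟨ PartialDerivatives.coeff-∂ ring j (baseChange F) γ ⟩
      suc (Vec.lookup γ j) × Polynomials.coeff ring (baseChange F) (raise j γ)
        ≈⟨ ×-congʳ (suc (Vec.lookup γ j)) (coeff-baseChange F (raise j γ)) ⟩
      suc (Vec.lookup γ j) × cast (coeff F (raise j γ))
        ≈⟨ ChainRule.×-homo ℤ-ring commutativeSemiring cast-homo (suc (Vec.lookup γ j)) _ ⟨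
      cast (suc (Vec.lookup γ j) ×ℤ coeff F (raise j γ))
        ≈⟨ ⟦⟧-cong (PartialDerivatives.coeff-∂ ℤ-ring j F γ) ⟨
      cast (gradient γ j) ∎
      where
      open MonoidMult +-monoid using (_×_; ×-congʳ)
      open MonoidMult (CommutativeRing.+-monoid ℤ-ring) using () renaming (_×_ to _×ℤ_)
      open import Relation.Binary.Reasoning.Setoid setoid

    full-order : ∀ {D} → KernelKilledBy rows D → IsUnit D → ¬ (1# ≈ 0#) → (∀ x y → Dec (x ≈ y)) →
      HasOrder ring (baseChange F) (suc n)
    full-order {D} killed (t , Dt≈1) 1≉0 _≈?_ = reducesTo-all (baseChange F) , λ k F↓k → ℕ.≮⇒≥ λ k<1+n →
      let A , (B , AB≈1 , BA≈1) , i , eliminated = reducesTo⇒eliminates _≈?_ (baseChange F) F↓k k<1+n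
          Aᵢ = λ j → A j i
          ∇F∙Aᵢ≈0 : ∀ γ → gradient γ ∙ Aᵢ ≈ 0#
          ∇F∙Aᵢ≈0 γ = trans
            (sum-cong-≋ {suc n} λ j → trans (*-comm (cast (gradient γ j)) (Aᵢ j)) (*-congˡ (sym (cast-gradient γ j))))
            (PartialDerivatives.directional-zero ring A i (baseChange F) (B , AB≈1 , BA≈1) eliminated γ)
          DAᵢ≈0 : ∀ j → cast D * Aᵢ j ≈ 0#
          DAᵢ≈0 = killed K Aᵢ (λ k → ∇F∙Aᵢ≈0 (List.lookup Γ k))
          Aᵢ≈0 : ∀ j → Aᵢ j ≈ 0#
          Aᵢ≈0 j = begin
            Aᵢ j                    ≈⟨ *-identityˡ _ ⟨
            1# * Aᵢ j               ≈⟨ *-congʳ (trans (*-comm _ _) Dt≈1) ⟨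
            t * cast D * Aᵢ j       ≈⟨ *-assoc _ _ _ ⟩
            t * (cast D * Aᵢ j)     ≈⟨ *-congˡ (DAᵢ≈0 j) ⟩
            t * 0#                  ≈⟨ zeroʳ _ ⟩
            0#                      ∎
      -- A zero column in `A` forces a zero on the diagonal of `B · A`.
      in 1≉0 (begin
        1#                            ≡⟨ δ-diagonal i ⟨
        δ i i                         ≈⟨ BA≈1 i i ⟨
        sum (λ j → B i j * A j i)     ≈⟨ sum-zero {suc n} (λ j → trans (*-congˡ (Aᵢ≈0 j)) (zeroʳ (B i j))) ⟩
        0#                            ∎)
      where
      open Orders ring
      open import Relation.Binary.Reasoning.Setoid setoid

  module _ (w : Vector ℤ (suc n)) (i : Fin (suc n)) (kernel : ∀ k → ℤ-Algebra._∙_ ℤ-algebra (rows k) w ≡ + 0) where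
    open ℤ-Algebra ℤ-algebra using (sum; sum-zero; sum-cong-≋; δ; δ-diagonal)

    private
      -- Subtracting the basis vector makes `1 + x i` equal to `w i`, which is thus the determinant
      -- of `A`.
      x : Vector ℤ (suc n)
      x j = w j ℤ.- δ j i

      -- The identity matrix with its i-th column replaced by w.
      A : Polynomials.Matrix ℤ-ring (suc n)
      A = Matrices.elementary ℤ-ring i x

      δ+[w-δ]*1 : ∀ d w → d ℤ.+ (w ℤ.- d) ℤ.* + 1 ≡ w
      δ+[w-δ]*1 = ℤ-Solver.solve-∀

      A-column : ∀ j → A j i ≡ w j
      A-column j = ≡.trans (≡.cong (λ d → δ j i ℤ.+ x j ℤ.* d) (δ-diagonal i)) (δ+[w-δ]*1 (δ j i) (w j))

      -- The kernel condition covers the listed exponents; at any other exponent all partial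
      -- derivatives have coefficient 0.
      ∇F∙w≡0 : ∀ γ → sum (λ j → gradient γ j ℤ.* w j) ≡ + 0
      ∇F∙w≡0 γ with DecMembership._∈?_ _≟ᵛ_ γ Γ
      ... | yes γ∈Γ = ≡.subst (λ γ → sum (λ j → gradient γ j ℤ.* w j) ≡ + 0) (≡.sym (Any.lookup-index γ∈Γ)) (kernel (Any.index γ∈Γ))
      ... | no  γ∉Γ = sum-zero {suc n} λ j → ≡.cong (ℤ._* w j) (PolynomialSemiring.coeff-∉ ℤ-ring (∂ j F) (γ∉Γ ∘ ∈Γ⁺ j))

    A-eliminates : Orders.Eliminates ℤ-ring F A i
    A-eliminates = PartialDerivatives.directional-zero⁻¹ ℤ-ring A i F ℤ-torsion-free λ γ → ≡.trans
      (sum-cong-≋ {suc n} λ j → ≡.trans (ℤ.*-comm (A j i) (gradient γ j)) (≡.cong (gradient γ j ℤ.*_) (A-column j)))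
      (∇F∙w≡0 γ)

    module _ (K : ℤ-Algebra) where
      private open module K = ℤ-Algebra K hiding (δ; δ-diagonal; sum; sum-zero; sum-cong-≋)
  
      -- The halves have different sources: the vanishing of coefficients is inherited from ℤ, while
      -- invertibility is established in `K`.
      reducible : IsUnit (w i) → Polynomials.ReducesTo ring (baseChange F) n
      reducible (t , wᵢt≈1) = Orders.eliminates⇒reducesTo ring (baseChange F) (λ j k → cast (A j k))
        (Matrices.Invertible-resp-≈ₘ ring cast-A (Matrices.elementary-invertible ring i (cast ∘ x) {t} (trans (*-congʳ 1+xᵢ≈wᵢ) wᵢt≈1)))
        λ α αᵢ≢0 → trans (PolynomialSemiring.coefficients (changeVariables-baseChange A F) α)
          (trans (coeff-baseChange (Polynomials.changeVariables ℤ-ring A F) α)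
            (trans (⟦⟧-cong (A-eliminates α αᵢ≢0)) 0#-homo))
        where
        cast-δ : ∀ j k → K.δ j k ≈ cast (δ j k)
        cast-δ j k with does (j Fin.≟ k)
        ... | true  = sym 1#-homo
        ... | false = sym 0#-homo
        cast-A : ∀ j k → Matrices.elementary ring i (cast ∘ x) j k ≈ cast (A j k)
        cast-A j k = sym (trans (+-homo _ _) (+-cong (sym (cast-δ j k)) (trans (*-homo _ _) (*-congˡ (sym (cast-δ i k))))))
        1+[w-1] : ∀ w → + 1 ℤ.+ (w ℤ.- + 1) ≡ w
        1+[w-1] = ℤ-Solver.solve-∀
        1+xᵢ≈wᵢ : 1# + cast (x i) ≈ cast (w i)
        1+xᵢ≈wᵢ = trans (+-congʳ (sym 1#-homo)) (trans (sym (+-homo _ _))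
          (⟦⟧-cong (≡.trans (≡.cong (λ d → + 1 ℤ.+ (w i ℤ.- d)) (δ-diagonal i)) (1+[w-1] (w i)))))

  -- Over prime fields either conclusion can fail only at primes dividing one nonzero integer,
  -- whence finitely many exceptions.
  order-dichotomy :
    (∃ λ D → D ≢ + 0 Product.× (∀ K → let open ℤ-Algebra K in
      IsUnit D → ¬ (1# ≈ 0#) → (∀ x y → Dec (x ≈ y)) → HasOrder ring (baseChange F) (suc n)))
    ⊎
    (∃ λ z → z ≢ + 0 Product.× (∀ K → let open ℤ-Algebra K in
      IsUnit z → Polynomials.ReducesTo ring (baseChange F) n))
  order-dichotomy with kernel-dichotomy rows
  ... | inj₁ (D , D≢0 , killed)         = inj₁ (D , D≢0 , λ K → full-order K killed)
  ... | inj₂ (w , (i , wᵢ≢0) , kernel) = inj₂ (w i , wᵢ≢0 , reducible w i kernel)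

-- The rationals and the prime fields

prime-divisor : ∀ m → m ≢ 0 → ∃ λ p → Prime p Product.× p ∣ suc m
prime-divisor m m≢0 with factorise (suc m)
... | record { factors = [] ; isFactorisation = 1+m≡1 } = contradiction (ℕ.suc-injective 1+m≡1) m≢0
... | record { factors = p ∷ ps ; isFactorisation = 1+m≡p*ps ; factorsPrime = p-prime ∷ _ } =
  p , p-prime , ℕ∣.divides (ℕ.product ps) (≡.trans 1+m≡p*ps (ℕ.*-comm p (ℕ.product ps)))

-- Euclid: a prime divisor of `m ! + 1` not exceeding `m` would divide `m !`, hence 1.
prime-above : ∀ m → ∃ λ p → Prime p Product.× m ℕ.< p
prime-above m with prime-divisor (m ℕ.!) (ℕ.m<n⇒n≢0 (ℕ.1≤n! m))
... | p , p-prime , p∣1+m! = p , p-prime , ℕ.≰⇒> λ p≤m → ¬prime[1] (≡.subst Prime (ℕ∣.∣1⇒≡1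
  (ℕ∣.∣m+n∣m⇒∣n (≡.subst (p ∣_) (ℕ.+-comm 1 (m ℕ.!)) p∣1+m!)
    (ℕ∣.∣-trans (n∣n! (prime⇒nonZero p-prime)) (ℕ∣.m≤n⇒m!∣n! p≤m)))) p-prime)
  where
  n∣n! : ∀ {n} → ℕ.NonZero n → n ∣ n ℕ.!
  n∣n! {suc n} _ = ℕ∣.m∣m*n (n ℕ.!)

prime-above-avoiding : ∀ m (xs : List ℕ) → ∃ λ p → Prime p Product.× p ∉ xs Product.× m ℕ.< p
prime-above-avoiding m xs with prime-above (max m xs)
... | p , p-prime , max<p = p , p-prime
  , (λ p∈xs → ℕ.<⇒≱ max<p (All.lookup (xs≤max m xs) p∈xs))
  , ℕ.≤-<-trans (⊥≤max m xs) max<p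

ℚ-algebra : ℤ-Algebra
ℚ-algebra = record
  { ring = ℚ-ring
  ; cast = ℚ._/ 1
  ; cast-homo = mkSemiringHomomorphism
      (≡.cong (ℚ._/ 1))
      -- Normalisation by a gcd does not compute on variables, so the equation is checked on
      -- unnormalised fractions.
      (λ a b → ℚ.toℚᵘ-injective (begin
        ℚ.toℚᵘ ((a ℤ.+ b) ℚ./ 1)                ≈⟨ ℚ.toℚᵘ-fromℚᵘ (mkℚᵘ (a ℤ.+ b) 0) ⟩
        mkℚᵘ (a ℤ.+ b) 0                        ≈⟨ *≡* (lemma a b) ⟩
        mkℚᵘ a 0 ℚᵘ.+ mkℚᵘ b 0                  ≈⟨ ℚᵘ.+-cong (ℚ.toℚᵘ-fromℚᵘ (mkℚᵘ a 0)) (ℚ.toℚᵘ-fromℚᵘ (mkℚᵘ b 0)) ⟨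
        ℚ.toℚᵘ (a ℚ./ 1) ℚᵘ.+ ℚ.toℚᵘ (b ℚ./ 1)  ≈⟨ ℚ.toℚᵘ-homo-+ (a ℚ./ 1) (b ℚ./ 1) ⟨
        ℚ.toℚᵘ (a ℚ./ 1 ℚ.+ b ℚ./ 1)            ∎))
      ≡.refl
      (λ a b → ℚ.toℚᵘ-injective (begin
        ℚ.toℚᵘ ((a ℤ.* b) ℚ./ 1)                ≈⟨ ℚ.toℚᵘ-fromℚᵘ (mkℚᵘ (a ℤ.* b) 0) ⟩
        mkℚᵘ a 0 ℚᵘ.* mkℚᵘ b 0                  ≈⟨ ℚᵘ.*-cong (ℚ.toℚᵘ-fromℚᵘ (mkℚᵘ a 0)) (ℚ.toℚᵘ-fromℚᵘ (mkℚᵘ b 0)) ⟨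
        ℚ.toℚᵘ (a ℚ./ 1) ℚᵘ.* ℚ.toℚᵘ (b ℚ./ 1)  ≈⟨ ℚ.toℚᵘ-homo-* (a ℚ./ 1) (b ℚ./ 1) ⟨
        ℚ.toℚᵘ ((a ℚ./ 1) ℚ.* (b ℚ./ 1))         ∎))
      ≡.refl }
  where
  open import Relation.Binary.Reasoning.Setoid ℚᵘ.≃-setoid
  lemma : ∀ a b → (a ℤ.+ b) ℤ.* + 1 ≡ (a ℤ.* + 1 ℤ.+ b ℤ.* + 1) ℤ.* + 1
  lemma = ℤ-Solver.solve-∀

ℚ-unit : ∀ {z} → z ≢ + 0 → ℤ-Algebra.IsUnit ℚ-algebra z
ℚ-unit {z} z≢0 = ℚ.1/ (z ℚ./ 1) , ℚ.*-inverseʳ (z ℚ./ 1)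
  where
  z/1≢0 : z ℚ./ 1 ≢ ℚ.0ℚ
  z/1≢0 z/1≡0 with ℚᵘ.≃-trans (ℚᵘ.≃-sym (ℚ.toℚᵘ-fromℚᵘ (mkℚᵘ z 0))) (ℚ.toℚᵘ-cong z/1≡0)
  ... | *≡* z*1≡0 = z≢0 (≡.trans (≡.sym (ℤ.*-identityʳ z)) z*1≡0)
  instance
    z/1-nonZero : ℚ.NonZero (z ℚ./ 1)
    z/1-nonZero = ℚ.≢-nonZero z/1≢0

𝔽-algebra : ℕ → ℤ-Algebra
𝔽-algebra p = record
  { ring = 𝔽 p
  ; cast = λ z → z
  ; cast-homo = mkSemiringHomomorphism (λ where ≡.refl → refl) (λ _ _ → refl) refl (λ _ _ → refl) refl }
  where open CommutativeRing (𝔽 p) using (refl)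

𝔽-≟ : ∀ p x y → Dec (x ≡ y mod p)
𝔽-≟ p x y = map′ congruent _≡_mod_.p∣x-y (+ p ℤ∣.∣? x ℤ.- y)

module _ {p} (p-prime : Prime p) where
  𝔽-nontrivial : ¬ (+ 1 ≡ + 0 mod p)
  𝔽-nontrivial (congruent p∣1) = ¬prime[1] (≡.subst Prime (ℕ∣.∣1⇒≡1 (ℤ∣.∣⇒∣ᵤ p∣1)) p-prime)

  private
    lift-Bézout : ∀ {a b c d} → 1 ℕ.+ a ℕ.* b ≡ c ℕ.* d → + 1 ℤ.+ + a ℤ.* + b ≡ + c ℤ.* + d
    lift-Bézout {a} {b} {c} {d} eq = ≡.trans (≡.cong (λ z → + 1 ℤ.+ z) (≡.sym (ℤ.pos-* a b))) (≡.trans (≡.cong +_ eq) (ℤ.pos-* c d))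

    -- The Bézout coefficient of `m` is the inverse, up to a sign depending on which form of the
    -- identity holds in ℕ.
    invert-ℕ : ∀ m .{{_ : ℕ.NonZero m}} → m ℕ.< p → ∃ λ t → + m ℤ.* t ≡ + 1 mod p
    invert-ℕ m m<p with coprime-Bézout (prime⇒coprime p-prime m<p)
    ... | Bézout.+- x y 1+ym≡xp = ℤ.- + y , congruent (divides (ℤ.- + x) (≡.trans (lemma (+ m) (+ y))
      (≡.trans (≡.cong ℤ.-_ (lift-Bézout {y} {m} {x} {p} 1+ym≡xp)) (ℤ.neg-distribˡ-* (+ x) (+ p)))))
      where
      lemma : ∀ m y → m ℤ.* (ℤ.- y) ℤ.- + 1 ≡ ℤ.- (+ 1 ℤ.+ y ℤ.* m)
      lemma = ℤ-Solver.solve-∀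
    ... | Bézout.-+ x y 1+xp≡ym = + y , congruent (divides (+ x) (≡.trans
      (≡.cong (ℤ._- + 1) (≡.trans (ℤ.*-comm (+ m) (+ y)) (≡.sym (lift-Bézout {x} {p} {y} {m} 1+xp≡ym))))
      (lemma (+ x ℤ.* + p))))
      where
      lemma : ∀ z → (+ 1 ℤ.+ z) ℤ.- + 1 ≡ z
      lemma = ℤ-Solver.solve-∀

  -- Size is a cruder criterion than divisibility, but it gives coprimality to a prime directly and
  -- still excludes only finitely many primes.
  𝔽-unit : ∀ {z} → z ≢ + 0 → ℤ.∣ z ∣ ℕ.< p → ℤ-Algebra.IsUnit (𝔽-algebra p) z
  𝔽-unit {+ 0}       z≢0 _   = contradiction ≡.refl z≢0
  𝔽-unit {+ suc m}   _   z<p = invert-ℕ (suc m) z<p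
  𝔽-unit { -[1+ m ]} _   z<p with invert-ℕ (suc m) z<p
  ... | t , mt≡1 = ℤ.- t , ≡.subst (λ z → z ≡ + 1 mod p) (≡.sym (lemma (+ suc m) t)) mt≡1
    where
    lemma : ∀ m t → (ℤ.- m) ℤ.* (ℤ.- t) ≡ m ℤ.* t
    lemma = ℤ-Solver.solve-∀

theorem3p12 : ∀ (n d : ℕ) (F : Poly ℤ-ring (suc n)) → IsForm ℤ-ring d F →
    HasOrder ℚ-ring (overℚ F) (suc n) ⇔
    (∃ λ (exceptions : List ℕ) → ∀ (p : ℕ) → Prime p → p ∉ exceptions → HasOrder (𝔽 p) (reduce p F) (suc n))
theorem3p12 n d F _ with Gradient.order-dichotomy F
-- Both sides of the equivalence hold outright.
... | inj₁ (D , D≢0 , full) = mk⇔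
  -- The list runs from 0 to `∣ D ∣` inclusive, so a prime outside it exceeds `∣ D ∣`.
  (λ _ → List.upTo (suc ℤ.∣ D ∣) , λ p p-prime p∉ →
    full (𝔽-algebra p) (𝔽-unit p-prime D≢0 (ℕ.≰⇒> λ p≤D → p∉ (∈.∈-upTo⁺ (ℕ.s≤s p≤D)))) (𝔽-nontrivial p-prime) (𝔽-≟ p))
  (λ _ → full ℚ-algebra (ℚ-unit D≢0) (λ ()) ℚ._≟_)
... | inj₂ (z , z≢0 , drop) = mk⇔
  (λ (_ , minimal) → contradiction (minimal n (drop ℚ-algebra (ℚ-unit z≢0))) ℕ.1+n≰n)
  (λ (exceptions , orders) → let p , p-prime , p∉ , z<p = prime-above-avoiding ℤ.∣ z ∣ exceptions
                                 _ , minimal = orders p p-prime p∉ in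
    contradiction (minimal n (drop (𝔽-algebra p) (𝔽-unit p-prime z≢0 z<p))) ℕ.1+n≰n)
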